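{- There exists $d_0$ such that for every integer $d\ge d_0$, every $d$-maximal set $S\subset[2]^\infty$ that contains no $1$-ball satisfies \[ |S|\le (4-10^{ -10})^d. \]
   Context: $[2]=\{1,2\}$ and $[2]^\infty$ is the set of infinite sequences over $[2]$. Hamming distance $\mathrm{dist}(a,b)=|\{i:a_i\ne b_i\}|$; $\mathrm{diam}(S)=\sup_{a,b\in S}\mathrm{dist}(a,b)$. $S$ is $d$-maximal if $\mathrm{diam}(S)=d$ and $S$ is inclusion-maximal among subsets of $[2]^\infty$ of diameter $d$. A $1$-ball is a set $\mathrm{Ball}(a,1)=\{b:\mathrm{dist}(a,b)\le1\}$ for some $a\in[2]^\infty$; $S$ contains a $1$-ball if $\mathrm{Ball}(a,1)\subset S$ for some $a$. -}

module Defs where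

open import Data.Nat using (ℕ; _≤_; _*_; _^_)
open import Data.Fin using (Fin)
open import Data.List using (List; length)
open import Data.List.Relation.Unary.All using (All)
open import Data.List.Relation.Unary.AllPairs using (AllPairs)
open import Data.List.Relation.Unary.Unique.Propositional using (Unique)
open import Data.Product using (Σ; ∃; _×_)
open import Relation.Binary.PropositionalEquality using (_≡_; _≢_)
open import Relation.Nullary using (¬_)

Seq : Set
Seq = ℕ → Fin 2

SeqSet : Set₁
SeqSet = Seq → Set

Differ : Seq → Seq → ℕ → Set
Differ a b i = a i ≢ b i

DistLe : Seq → Seq → ℕ → Set
DistLe a b k = (is : List ℕ) → Unique is → All (Differ a b) is → length is ≤ k

DistGe : Seq → Seq → ℕ → Set
DistGe a b k = Σ (List ℕ) λ is → Unique is × All (Differ a b) is × length is ≡ k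

-- diam(S) = d  (sup over ℕ ∪ {∞} equals d iff all distances ≤ d and d is attained)
Diam : SeqSet → ℕ → Set
Diam S d = ((a b : Seq) → S a → S b → DistLe a b d)
         × Σ Seq λ a → Σ Seq λ b → S a × S b × DistGe a b d

Maximal : ℕ → SeqSet → Set₁
Maximal d S = Diam S d
            × ((T : SeqSet) → ((a : Seq) → S a → T a) → Diam T d → (a : Seq) → T a → S a)

ContainsBall1 : SeqSet → Set
ContainsBall1 S = Σ Seq λ a → (b : Seq) → DistLe a b 1 → S b

Distinct : Seq → Seq → Set
Distinct a b = ∃ λ i → a i ≢ b i

-- |S| ≤ (4 - 10^{-10})^d, i.e. |S| · 10^{10 d} ≤ (4·10^{10} - 1)^d,
-- stated for every finite list of distinct elements of S.
CardBound : ℕ → SeqSet → Set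
CardBound d S = (xs : List Seq) → AllPairs Distinct xs → All S xs →
  length xs * (10 ^ (10 * d)) ≤ 39999999999 ^ d

{-# OPTIONS --safe #-}

-- Every point T has some x ∈ S with dist(x,T) ≥ d, as otherwise maximality would put Ball(T,1)
-- into S.  Fix c ∈ S, a point T at distance τ from c, and let N be the number of a ∈ S with T on
-- a geodesic from c to a and dist(a,T) = r.  Double counting the pairs (a,i) with aᵢ = xᵢ ≠ Tᵢ,
-- x far from T, and inducting on r gives N ≤ C(2d - τ, r); for T = c this is already |S| ≲ 4^d.
--
-- To gain, let c, u ∈ S be at distance d, let U be the set of the d coordinates where they differ
-- and s = ⌊d/16⌋.  If the traces of S on U shatter some I ⊆ U of size s, then each a ∈ S has a
-- c′ ∈ S opposite to it on all of I; taking τ = s gives |S| ≤ 2^s Σ_{r ≤ d - s} C(2d - s, r).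
-- Otherwise Sauer–Shelah leaves at most Σ_{i < s} C(d, i) traces, and the elements with a given
-- trace differ from c at most d/2 times off U, hence are at most Σ_{r ≤ d/2} C(2d, r) many.
-- Both bounds are exponentially smaller than 4^d.
--
-- Members of S are infinite sequences, so supports and far points are only available up to double
-- negation; this suffices because the inequality to be proved is decidable.
module Submission where

open import Defs
open import Data.Bool using (Bool; true; false; _∨_; _∧_)
open import Data.Empty using (⊥-elim)
open import Data.Fin using (Fin; zero; suc; opposite)
open import Data.Fin.Properties using (_≟_)
open import Data.List using (List; []; _∷_; length; filter; map; take)
open import Data.List.Membership.Propositional using (_∈_)
open import Data.List.Properties using (length-take)
open import Data.List.Relation.Binary.Sublist.Propositional using (_⊆_; []; _∷_; _∷ʳ_)
open import Data.List.Relation.Binary.Sublist.Propositional.Properties using (All-resp-⊆; []⊆-universal)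
open import Data.List.Relation.Unary.All as All using (All; []; _∷_)
import Data.List.Relation.Unary.All.Properties as AllP
open import Data.List.Relation.Unary.AllPairs using (AllPairs; []; _∷_)
import Data.List.Relation.Unary.AllPairs.Properties as AllPairsP
open import Data.List.Relation.Unary.Unique.Propositional using (Unique)
open import Data.Nat hiding (_≟_)
open import Data.Nat.Combinatorics using (_C_; nCk+nC[k+1]≡[n+1]C[k+1]; nC1≡n)
open import Data.Nat.DivMod using (m%n<n; m≡m%n+[m/n]*n; m/n*n≤m; /-monoˡ-≤; m*n/n≡m)
open import Data.Nat.ListAction using (sum)
open import Data.Nat.Properties hiding (_≟_)
import Data.Nat.Properties as ℕ
open import Data.List.Membership.DecPropositional ℕ._≟_ using (_∈?_)
open import Data.Nat.Tactic.RingSolver using (solve-∀)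
open import Data.Product using (Σ; _×_; _,_; proj₁; proj₂)
open import Data.Sum using (_⊎_; inj₁; inj₂)
open import Data.Vec using (Vec; []; _∷_)
open import Data.Vec.Properties using (≡-dec; ∷-injectiveˡ; ∷-injectiveʳ)
open import Function using (_∘_; case_of_)
open import Relation.Binary.PropositionalEquality
open import Relation.Nullary using (¬_; Dec; yes; no; ¬?; contradiction)
open import Relation.Nullary.Decidable using (decidable-stable; from-yes)

-- Finite sums

Σ< : ℕ → (ℕ → ℕ) → ℕ
Σ< zero    f = 0
Σ< (suc N) f = Σ< N f + f N

Σ<-cong : ∀ N {f g} → (∀ i → f i ≡ g i) → Σ< N f ≡ Σ< N g
Σ<-cong zero    h = refl
Σ<-cong (suc N) h = cong₂ _+_ (Σ<-cong N h) (h N)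

Σ<-mono : ∀ N {f g} → (∀ i → i < N → f i ≤ g i) → Σ< N f ≤ Σ< N g
Σ<-mono zero    h = z≤n
Σ<-mono (suc N) h = +-mono-≤ (Σ<-mono N (λ i i<N → h i (m<n⇒m<1+n i<N))) (h N (n<1+n N))

Σ<-+ : ∀ N f g → Σ< N (λ i → f i + g i) ≡ Σ< N f + Σ< N g
Σ<-+ zero    f g = refl
Σ<-+ (suc N) f g = trans (cong (_+ (f N + g N)) (Σ<-+ N f g)) (shuffle (Σ< N f) (Σ< N g) (f N) (g N))
  where
  shuffle : ∀ a b c e → a + b + (c + e) ≡ a + c + (b + e)
  shuffle = solve-∀

Σ<-*ˡ : ∀ N k f → Σ< N (λ i → k * f i) ≡ k * Σ< N f
Σ<-*ˡ zero    k f = sym (*-zeroʳ k)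
Σ<-*ˡ (suc N) k f = trans (cong (_+ k * f N) (Σ<-*ˡ N k f)) (sym (*-distribˡ-+ k _ _))

Σ<-*ʳ : ∀ N k f → Σ< N (λ i → f i * k) ≡ Σ< N f * k
Σ<-*ʳ N k f = trans (Σ<-cong N (λ i → *-comm (f i) k)) (trans (Σ<-*ˡ N k f) (*-comm k _))

Σ<-0 : ∀ N → Σ< N (λ _ → 0) ≡ 0
Σ<-0 zero    = refl
Σ<-0 (suc N) = trans (+-identityʳ _) (Σ<-0 N)

Σ<-extend : ∀ {N M f} → N ≤ M → (∀ i → N ≤ i → f i ≡ 0) → Σ< M f ≡ Σ< N f
Σ<-extend {N} {M} {f} N≤M h = go (≤⇒≤′ N≤M)
  where
  go : ∀ {M} → N ≤′ M → Σ< M f ≡ Σ< N f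
  go ≤′-refl                = refl
  go (≤′-step {M} N≤′M) = trans (cong₂ _+_ (go N≤′M) (h M (≤′⇒≤ N≤′M))) (+-identityʳ _)

Σ<-bump : ∀ N {f g i} → i < N → (∀ j → j ≢ i → f j ≡ g j) → f i ≡ suc (g i) →
          Σ< N f ≡ suc (Σ< N g)
Σ<-bump (suc N) {f} {g} {i} i<1+N off at with i ℕ.≟ N
... | yes refl = trans (cong₂ _+_ (below N ≤-refl) at) (+-suc _ _)
  where
  below : ∀ M → M ≤ i → Σ< M f ≡ Σ< M g
  below zero    _   = refl
  below (suc M) M<i = cong₂ _+_ (below M (<⇒≤ M<i)) (off M (<⇒≢ M<i))
... | no  i≢N = cong₂ _+_ (Σ<-bump N (≤∧≢⇒< (s≤s⁻¹ i<1+N) i≢N) off at) (off N (i≢N ∘ sym))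

unique-length≤Σ< : ∀ N f is → Unique is → All (λ i → i < N × 1 ≤ f i) is → length is ≤ Σ< N f
unique-length≤Σ< N f []       _            _                      = z≤n
unique-length≤Σ< N f (i ∷ is) (i∉is ∷ uniq) ((i<N , 1≤fi) ∷ pos) = begin
  suc (length is) ≤⟨ s≤s (unique-length≤Σ< N g is uniq pos′) ⟩
  suc (Σ< N g)    ≡⟨ sym (Σ<-bump N i<N off at) ⟩
  Σ< N f          ∎
  where
  open ≤-Reasoning
  -- One unit of the total is charged to `i`. The later entries all differ from `i`, so they keep
  -- their positive values under `g`.
  g : ℕ → ℕ
  g j with j ℕ.≟ i
  ... | yes _ = pred (f j)
  ... | no  _ = f j
  off : ∀ j → j ≢ i → f j ≡ g j
  off j j≢i with j ℕ.≟ i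
  ... | yes j≡i = contradiction j≡i j≢i
  ... | no  _   = refl
  at : f i ≡ suc (g i)
  at with i ℕ.≟ i
  ... | yes _   = sym (suc-pred (f i) {{>-nonZero 1≤fi}})
  ... | no  i≢i = contradiction refl i≢i
  pos′ : All (λ j → j < N × 1 ≤ g j) is
  pos′ = All.zipWith (λ { {j} (i≢j , j<N , 1≤fj) → j<N , subst (1 ≤_) (off j (i≢j ∘ sym)) 1≤fj })
                     (i∉is , pos)

sum-Σ<-swap : ∀ {A : Set} N (f : A → ℕ → ℕ) xs →
              sum (map (λ a → Σ< N (f a)) xs) ≡ Σ< N (λ i → sum (map (λ a → f a i) xs))
sum-Σ<-swap N f []       = sym (Σ<-0 N)
sum-Σ<-swap N f (x ∷ xs) = trans (cong (Σ< N (f x) +_) (sum-Σ<-swap N f xs)) (sym (Σ<-+ N _ _))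

sum-map-mono : ∀ {A : Set} {f g : A → ℕ} xs → All (λ a → f a ≤ g a) xs →
               sum (map f xs) ≤ sum (map g xs)
sum-map-mono []       []       = z≤n
sum-map-mono (x ∷ xs) (p ∷ ps) = +-mono-≤ p (sum-map-mono xs ps)

sum-map-const : ∀ {A : Set} k (xs : List A) → sum (map (λ _ → k) xs) ≡ length xs * k
sum-map-const k []       = refl
sum-map-const k (x ∷ xs) = cong (k +_) (sum-map-const k xs)

sum-map-*ˡ : ∀ {A : Set} k (f : A → ℕ) xs → sum (map (λ a → k * f a) xs) ≡ k * sum (map f xs)
sum-map-*ˡ k f []       = sym (*-zeroʳ k)
sum-map-*ˡ k f (x ∷ xs) = trans (cong (k * f x +_) (sum-map-*ˡ k f xs)) (sym (*-distribˡ-+ k _ _))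

-- Binomial coefficients

-- Pascal's rule splits it into two smaller instances. It is the identity that closes the double
-- count in `count≤C`.
C-absorption : ∀ n k → suc k * (suc n C suc k) ≡ suc n * (n C k)
C-absorption zero    zero    = refl
C-absorption zero    (suc k) = *-zeroʳ (suc (suc k))
C-absorption (suc n) zero    = trans (*-identityˡ _) (trans (nC1≡n (suc (suc n))) (sym (*-identityʳ _)))
C-absorption (suc n) (suc k) = begin
  suc (suc k) * (suc (suc n) C suc (suc k))
    ≡⟨ cong (suc (suc k) *_) (sym (nCk+nC[k+1]≡[n+1]C[k+1] (suc n) (suc k))) ⟩
  suc (suc k) * (x + y)                     ≡⟨ split (suc k) x y ⟩
  x + suc k * x + suc (suc k) * y           ≡⟨ cong₂ (λ u v → x + u + v) (C-absorption n k) (C-absorption n (suc k)) ⟩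
  x + suc n * (n C k) + suc n * (n C suc k) ≡⟨ merge x (suc n) (n C k) (n C suc k) ⟩
  x + suc n * (n C k + n C suc k)           ≡⟨ cong (λ z → x + suc n * z) (nCk+nC[k+1]≡[n+1]C[k+1] n k) ⟩
  suc (suc n) * x                           ∎
  where
  open ≡-Reasoning
  x = suc n C suc k
  y = suc n C suc (suc k)
  split : ∀ k x y → suc k * (x + y) ≡ x + k * x + suc k * y
  split = solve-∀
  merge : ∀ x n a b → x + n * a + n * b ≡ x + n * (a + b)
  merge = solve-∀

-- Φ n s counts the subsets of an n-element set with fewer than s elements.
Φ : ℕ → ℕ → ℕ
Φ n       zero    = 0
Φ zero    (suc s) = 1
Φ (suc n) (suc s) = Φ n (suc s) + Φ n s

Φ-suc : ∀ n s → Φ n (suc s) ≡ Φ n s + n C s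
Φ-suc zero    zero    = refl
Φ-suc zero    (suc s) = refl
Φ-suc (suc n) zero    = trans (+-identityʳ _) (Φ-suc n zero)
Φ-suc (suc n) (suc s) = begin
  Φ n (suc (suc s)) + Φ n (suc s)                     ≡⟨ cong₂ _+_ (Φ-suc n (suc s)) (Φ-suc n s) ⟩
  (Φ n (suc s) + n C suc s) + (Φ n s + n C s)         ≡⟨ shuffle (Φ n (suc s)) (n C suc s) (Φ n s) (n C s) ⟩
  (Φ n (suc s) + Φ n s) + (n C s + n C suc s)         ≡⟨ cong (Φ n (suc s) + Φ n s +_) (nCk+nC[k+1]≡[n+1]C[k+1] n s) ⟩
  Φ n (suc s) + Φ n s + suc n C suc s                 ∎
  where
  open ≡-Reasoning
  shuffle : ∀ a b c e → (a + b) + (c + e) ≡ (a + c) + (e + b)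
  shuffle = solve-∀

Φ-monoˡ : ∀ {n m} s → n ≤ m → Φ n s ≤ Φ m s
Φ-monoˡ {m = m} zero _ = z≤n
Φ-monoˡ {zero}  {zero}  (suc s) _ = ≤-refl
Φ-monoˡ {zero}  {suc m} (suc s) _ = ≤-trans (Φ-monoˡ {zero} {m} (suc s) z≤n) (m≤m+n _ _)
Φ-monoˡ {suc n} {suc m} (suc s) (s≤s n≤m) = +-mono-≤ (Φ-monoˡ (suc s) n≤m) (Φ-monoˡ s n≤m)

-- The Chernoff bound for the lower binomial tail at the bias a / (a + b), cleared of denominators.
Φ-tail : ∀ {a b} → a ≤ b → ∀ n s → Φ n s * (a ^ s * b ^ n) ≤ (a + b) ^ n * b ^ s
Φ-tail a≤b n       zero    = z≤n
Φ-tail {a} {b} a≤b zero (suc s) = begin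
  1 * (a ^ suc s * 1) ≡⟨ trans (*-identityˡ _) (*-identityʳ _) ⟩
  a ^ suc s           ≤⟨ ^-monoˡ-≤ (suc s) a≤b ⟩
  b ^ suc s           ≡⟨ sym (*-identityˡ _) ⟩
  1 * b ^ suc s       ∎
  where open ≤-Reasoning
Φ-tail {a} {b} a≤b (suc n) (suc s) = begin
  (Φ n (suc s) + Φ n s) * (a ^ suc s * b ^ suc n)
    ≡⟨ split (Φ n (suc s)) (Φ n s) a b (a ^ s) (b ^ n) ⟩
  b * (Φ n (suc s) * (a ^ suc s * b ^ n)) + a * b * (Φ n s * (a ^ s * b ^ n))
    ≤⟨ +-mono-≤ (*-monoʳ-≤ b (Φ-tail a≤b n (suc s))) (*-monoʳ-≤ (a * b) (Φ-tail a≤b n s)) ⟩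
  b * ((a + b) ^ n * b ^ suc s) + a * b * ((a + b) ^ n * b ^ s)
    ≡⟨ merge a b ((a + b) ^ n) (b ^ s) ⟩
  (a + b) ^ suc n * b ^ suc s ∎
  where
  open ≤-Reasoning
  split : ∀ u v a b p q → (u + v) * (a * p * (b * q)) ≡ b * (u * (a * p * q)) + a * b * (v * (p * q))
  split = solve-∀
  merge : ∀ a b p q → b * (p * (b * q)) + a * b * (p * q) ≡ (a + b) * p * (b * q)
  merge = solve-∀

-- Hamming distance on a window

ne : Fin 2 → Fin 2 → ℕ
ne zero       zero       = 0
ne zero       (suc zero) = 1
ne (suc zero) zero       = 1
ne (suc zero) (suc zero) = 0

ne-≡ : ∀ {x y} → x ≡ y → ne x y ≡ 0
ne-≡ {zero}     refl = refl
ne-≡ {suc zero} refl = refl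

ne-≢ : ∀ {x y} → x ≢ y → ne x y ≡ 1
ne-≢ {zero}     {zero}     x≢y = contradiction refl x≢y
ne-≢ {zero}     {suc zero} x≢y = refl
ne-≢ {suc zero} {zero}     x≢y = refl
ne-≢ {suc zero} {suc zero} x≢y = contradiction refl x≢y

ne≡0 : ∀ x y → ne x y ≡ 0 → x ≡ y
ne≡0 zero       zero       _ = refl
ne≡0 zero       (suc zero) ()
ne≡0 (suc zero) zero       ()
ne≡0 (suc zero) (suc zero) _ = refl

≢-opposite : ∀ {x y : Fin 2} → x ≢ y → opposite x ≡ y
≢-opposite {zero}     {zero}     x≢y = contradiction refl x≢y
≢-opposite {zero}     {suc zero} x≢y = refl
≢-opposite {suc zero} {zero}     x≢y = refl
≢-opposite {suc zero} {suc zero} x≢y = contradiction refl x≢y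

opposite-≢ : ∀ (x : Fin 2) → opposite x ≢ x
opposite-≢ zero       ()
opposite-≢ (suc zero) ()

-- A number that can be computed, unlike the full Hamming distance. The two coincide once
-- `Agree N a b` holds, which is why that condition accompanies the counts below.
dist : ℕ → Seq → Seq → ℕ
dist N a b = Σ< N (λ i → ne (a i) (b i))

Agree : ℕ → Seq → Seq → Set
Agree N a b = ∀ i → N ≤ i → a i ≡ b i

Agree-sym : ∀ {N a b} → Agree N a b → Agree N b a
Agree-sym ag i N≤i = sym (ag i N≤i)

Agree-trans : ∀ {N a b c} → Agree N a b → Agree N b c → Agree N a c
Agree-trans ab bc i N≤i = trans (ab i N≤i) (bc i N≤i)

Agree-mono : ∀ {N M a b} → N ≤ M → Agree N a b → Agree M a b
Agree-mono N≤M ag i M≤i = ag i (≤-trans N≤M M≤i)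

dist-extend : ∀ {N M a b} → N ≤ M → Agree N a b → dist M a b ≡ dist N a b
dist-extend N≤M ag = Σ<-extend N≤M (λ i N≤i → ne-≡ (ag i N≤i))

diffs : ℕ → Seq → Seq → List ℕ
diffs zero    a b = []
diffs (suc N) a b with a N ≟ b N
... | yes _ = diffs N a b
... | no  _ = N ∷ diffs N a b

diffs-< : ∀ N a b → All (_< N) (diffs N a b)
diffs-< zero    a b = []
diffs-< (suc N) a b with a N ≟ b N
... | yes _ = All.map m<n⇒m<1+n (diffs-< N a b)
... | no  _ = n<1+n N ∷ All.map m<n⇒m<1+n (diffs-< N a b)

diffs-unique : ∀ N a b → Unique (diffs N a b)
diffs-unique zero    a b = []
diffs-unique (suc N) a b with a N ≟ b N
... | yes _ = diffs-unique N a b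
... | no  _ = All.map (λ i<N N≡i → <⇒≢ i<N (sym N≡i)) (diffs-< N a b) ∷ diffs-unique N a b

diffs-differ : ∀ N a b → All (Differ a b) (diffs N a b)
diffs-differ zero    a b = []
diffs-differ (suc N) a b with a N ≟ b N
... | yes _    = diffs-differ N a b
... | no  a≢b = a≢b ∷ diffs-differ N a b

length-diffs : ∀ N a b → length (diffs N a b) ≡ dist N a b
length-diffs zero    a b = refl
length-diffs (suc N) a b with a N ≟ b N
... | yes a≡b = trans (length-diffs N a b) (sym (trans (cong (dist N a b +_) (ne-≡ a≡b)) (+-identityʳ _)))
... | no  a≢b = trans (cong suc (length-diffs N a b))
                      (sym (trans (cong (dist N a b +_) (ne-≢ a≢b)) (+-comm _ 1)))

DistLe⇒dist≤ : ∀ {a b k} → DistLe a b k → ∀ N → dist N a b ≤ k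
DistLe⇒dist≤ {a} {b} le N =
  subst (_≤ _) (length-diffs N a b) (le _ (diffs-unique N a b) (diffs-differ N a b))

differ-length≤dist : ∀ {N a b} is → Unique is → All (Differ a b) is → Agree N a b →
                     length is ≤ dist N a b
differ-length≤dist {N} {a} {b} is uniq differ ag =
  unique-length≤Σ< N _ is uniq (All.map (λ {i} a≢b → below i a≢b , ≤-reflexive (sym (ne-≢ a≢b))) differ)
  where
  below : ∀ i → Differ a b i → i < N
  below i a≢b = ≰⇒> (λ N≤i → a≢b (ag i N≤i))

DistGe⇒≤dist : ∀ {N a b k} → DistGe a b k → Agree N a b → k ≤ dist N a b
DistGe⇒≤dist (is , uniq , differ , refl) = differ-length≤dist is uniq differ

-- Induction on the number of differences still allowed beyond `M`. Whether one remains is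
-- undecidable, hence the double negation: a difference at `i` would restart the search after `i`
-- with one fewer allowed, and with none allowed it is absurd.
DistLe⇒Agree : ∀ {a b k} → DistLe a b k → ¬ ¬ (Σ ℕ λ N → Agree N a b)
DistLe⇒Agree {a} {b} {k} le = go k 0 (λ is uniq ds → le is uniq (All.map proj₂ ds))
  where
  go : ∀ k M → (∀ is → Unique is → All (λ i → M ≤ i × Differ a b i) is → length is ≤ k) →
       ¬ ¬ (Σ ℕ λ N → Agree N a b)
  go k M bound none = none (M , λ i M≤i → decidable-stable (a i ≟ b i) (λ a≢b → step k bound i M≤i a≢b))
    where
    step : ∀ k → (∀ is → Unique is → All (λ i → M ≤ i × Differ a b i) is → length is ≤ k) →
           ∀ i → M ≤ i → ¬ Differ a b i
    step zero    bound i M≤i a≢b = case bound (i ∷ []) ([] ∷ []) ((M≤i , a≢b) ∷ []) of λ ()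
    step (suc k) bound i M≤i a≢b = go k (suc i) bound′ none
      where
      bound′ : ∀ is → Unique is → All (λ j → suc i ≤ j × Differ a b j) is → length is ≤ k
      bound′ is uniq ds = s≤s⁻¹ (bound (i ∷ is) (All.map (λ { (i<j , _) → <⇒≢ i<j }) ds ∷ uniq)
        ((M≤i , a≢b) ∷ All.map (λ { (i<j , d) → ≤-trans M≤i (<⇒≤ i<j) , d }) ds))

-- Far points from maximality

length-filter-split : ∀ {A : Set} {P : A → Set} (P? : ∀ a → Dec (P a)) xs →
                      length xs ≡ length (filter (¬? ∘ P?) xs) + length (filter P? xs)
length-filter-split P? []       = refl
length-filter-split P? (x ∷ xs) with P? x
... | yes _ = trans (cong suc (length-filter-split P? xs)) (sym (+-suc _ _))
... | no  _ = cong suc (length-filter-split P? xs)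

-- If no member reached distance `d` from `T`, any `b` within 1 of `T` would be within `d` of all of
-- `S`. Adjoining `b` alone would keep the diameter at `d`, so maximality would already have `b` in
-- `S`.
exists-far : ∀ {d S} → Maximal d S → ¬ ContainsBall1 S →
             ∀ T → ¬ ¬ (Σ Seq λ x → S x × DistGe x T d)
exists-far {d} {S} ((close , a₀ , b₀ , Sa₀ , Sb₀ , ge) , maximal) noBall T none =
  noBall (T , λ b near → maximal (λ a → S a ⊎ a ≡ b) (λ _ → inj₁) (diam b near) b (inj₂ refl))
  where
  near-close : ∀ {b s} → DistLe T b 1 → S s → DistLe s b d
  near-close {b} {s} near Ss is uniq ds with length is ≤? d
  ... | yes len≤d = len≤d
  -- Among more than `d` differences between `s` and `b`, at most one is a difference between `T`
  -- and `b`. The others separate `s` from `T`; `take d` trims them to the exact length in `DistGe`.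
  ... | no  len≰d = ⊥-elim (none (s , Ss , take d js , AllPairsP.take⁺ d js-unique , AllP.take⁺ d js-differ ,
                                   trans (length-take d js) (m≤n⇒m⊓n≡m d≤js)))
    where
    same? : ∀ i → Dec (T i ≡ b i)
    same? i = T i ≟ b i
    js : List ℕ
    js = filter same? is
    js-unique : Unique js
    js-unique = AllPairsP.filter⁺ same? uniq
    js-differ : All (Differ s T) js
    js-differ = All.zipWith (λ (T≡b , s≢b) s≡T → s≢b (trans s≡T T≡b))
                            (AllP.all-filter same? is , AllP.filter⁺ same? ds)
    rest≤1 : length (filter (¬? ∘ same?) is) ≤ 1
    rest≤1 = near _ (AllPairsP.filter⁺ (¬? ∘ same?) uniq) (AllP.all-filter (¬? ∘ same?) is)
    d≤js : d ≤ length js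
    d≤js = s≤s⁻¹ (begin
      suc d                                              ≤⟨ ≰⇒> len≰d ⟩
      length is                                          ≡⟨ length-filter-split same? is ⟩
      length (filter (¬? ∘ same?) is) + length js          ≤⟨ +-monoˡ-≤ (length js) rest≤1 ⟩
      suc (length js)                                    ∎)
      where open ≤-Reasoning
  DistLe-sym : ∀ {a b k} → DistLe a b k → DistLe b a k
  DistLe-sym le is uniq ds = le is uniq (All.map (_∘ sym) ds)
  diam : ∀ b → DistLe T b 1 → Diam (λ a → S a ⊎ a ≡ b) d
  diam b near = bound , a₀ , b₀ , inj₁ Sa₀ , inj₁ Sb₀ , ge
    where
    bound : ∀ x y → S x ⊎ x ≡ b → S y ⊎ y ≡ b → DistLe x y d
    bound x y (inj₁ Sx)   (inj₁ Sy)   = close x y Sx Sy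
    bound x y (inj₁ Sx)   (inj₂ refl) = near-close near Sx
    bound x y (inj₂ refl) (inj₁ Sy)   = DistLe-sym (near-close near Sy)
    bound x y (inj₂ refl) (inj₂ refl) []      _ _         = z≤n
    bound x y (inj₂ refl) (inj₂ refl) (i ∷ _) _ (b≢b ∷ _) = contradiction refl b≢b

-- Geodesics and coordinatewise identities

Between : Seq → Seq → Seq → Set
Between c T a = ∀ i → T i ≡ c i ⊎ T i ≡ a i

-- With two letters, `x` and `a` both differing from `t` must be equal, so the product marks exactly
-- the coordinates overcounted by the triangle inequality through `t`.
ne-parallelogram : ∀ x a t → ne x a + 2 * (ne x t * ne a t) ≡ ne x t + ne a t
ne-parallelogram zero       zero       zero       = refl
ne-parallelogram zero       zero       (suc zero) = refl
ne-parallelogram zero       (suc zero) zero       = refl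
ne-parallelogram zero       (suc zero) (suc zero) = refl
ne-parallelogram (suc zero) zero       zero       = refl
ne-parallelogram (suc zero) zero       (suc zero) = refl
ne-parallelogram (suc zero) (suc zero) zero       = refl
ne-parallelogram (suc zero) (suc zero) (suc zero) = refl

-- The preceding identity with `x` as the centre; it evaluates the sum of the `q` in `count≤C`.
ne-median : ∀ x c t → 2 * (ne x c * ne x t) + ne t c ≡ ne x c + ne x t
ne-median zero       zero       zero       = refl
ne-median zero       zero       (suc zero) = refl
ne-median zero       (suc zero) zero       = refl
ne-median zero       (suc zero) (suc zero) = refl
ne-median (suc zero) zero       zero       = refl
ne-median (suc zero) zero       (suc zero) = refl
ne-median (suc zero) (suc zero) zero       = refl
ne-median (suc zero) (suc zero) (suc zero) = refl

ne-between : ∀ {c t a} → t ≡ c ⊎ t ≡ a → ne t c + ne a t ≡ ne a c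
ne-between {c} {a = a} (inj₁ refl) = cong (_+ ne a c) (ne-≡ {c} refl)
ne-between {c} {a = a} (inj₂ refl) = trans (cong (ne a c +_) (ne-≡ {a} refl)) (+-identityʳ _)

ne-idem : ∀ x c → ne x c * ne x c ≡ ne x c
ne-idem zero       zero       = refl
ne-idem zero       (suc zero) = refl
ne-idem (suc zero) zero       = refl
ne-idem (suc zero) (suc zero) = refl

-- If `x` and `a` both differ from `t`, then betweenness forces `t` to be `c`, so `x` differs from
-- `c` as well: each coordinate counted by `g` is one counted by `q`.
ne-gain : ∀ x {c t a} → t ≡ c ⊎ t ≡ a → ne x t * ne a t ≡ ne x c * ne x t * ne a t
ne-gain x {c} {a = a} (inj₁ refl) = cong (_* ne a c) (sym (ne-idem x c))
ne-gain x {c} {t} {a} (inj₂ refl) rewrite ne-≡ {a} refl = trans (*-zeroʳ (ne x a)) (sym (*-zeroʳ (ne x c * ne x a)))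

-- Again because there are two letters. Flipping `T` at a coordinate counted by `q` therefore moves
-- it away from `c`.
ne-both : ∀ x c t → ne x c * ne x t ≡ 0 ⊎ t ≡ c
ne-both zero       zero       _          = inj₁ refl
ne-both zero       (suc zero) zero       = inj₁ refl
ne-both zero       (suc zero) (suc zero) = inj₂ refl
ne-both (suc zero) zero       zero       = inj₂ refl
ne-both (suc zero) zero       (suc zero) = inj₁ refl
ne-both (suc zero) (suc zero) _          = inj₁ refl

ne≤1 : ∀ x y → ne x y ≤ 1
ne≤1 zero       zero       = z≤n
ne≤1 zero       (suc zero) = ≤-refl
ne≤1 (suc zero) zero       = ≤-refl
ne≤1 (suc zero) (suc zero) = z≤n

dist-parallelogram : ∀ N x a T → dist N x a + 2 * Σ< N (λ i → ne (x i) (T i) * ne (a i) (T i))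
                                 ≡ dist N x T + dist N a T
dist-parallelogram N x a T = begin
  dist N x a + 2 * Σ< N g                   ≡⟨ cong (dist N x a +_) (sym (Σ<-*ˡ N 2 g)) ⟩
  dist N x a + Σ< N (λ i → 2 * g i)         ≡⟨ sym (Σ<-+ N _ _) ⟩
  Σ< N (λ i → ne (x i) (a i) + 2 * g i)     ≡⟨ Σ<-cong N (λ i → ne-parallelogram (x i) (a i) (T i)) ⟩
  Σ< N (λ i → ne (x i) (T i) + ne (a i) (T i)) ≡⟨ Σ<-+ N _ _ ⟩
  dist N x T + dist N a T                   ∎
  where
  open ≡-Reasoning
  g : ℕ → ℕ
  g i = ne (x i) (T i) * ne (a i) (T i)

dist-median : ∀ N x c T → 2 * Σ< N (λ i → ne (x i) (c i) * ne (x i) (T i)) + dist N T c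
                          ≡ dist N x c + dist N x T
dist-median N x c T = begin
  2 * Σ< N q + dist N T c                   ≡⟨ cong (_+ dist N T c) (sym (Σ<-*ˡ N 2 q)) ⟩
  Σ< N (λ i → 2 * q i) + dist N T c         ≡⟨ sym (Σ<-+ N _ _) ⟩
  Σ< N (λ i → 2 * q i + ne (T i) (c i))     ≡⟨ Σ<-cong N (λ i → ne-median (x i) (c i) (T i)) ⟩
  Σ< N (λ i → ne (x i) (c i) + ne (x i) (T i)) ≡⟨ Σ<-+ N _ _ ⟩
  dist N x c + dist N x T                   ∎
  where
  open ≡-Reasoning
  q : ℕ → ℕ
  q i = ne (x i) (c i) * ne (x i) (T i)

dist-between : ∀ {N c T a} → Between c T a → dist N T c + dist N a T ≡ dist N a c
dist-between {N} btw = trans (sym (Σ<-+ N _ _)) (Σ<-cong N (λ i → ne-between (btw i)))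

dist≡0⇒≡ : ∀ {N a b} → dist N a b ≡ 0 → Agree N a b → ∀ i → a i ≡ b i
dist≡0⇒≡ {zero}          _  ag i = ag i z≤n
dist≡0⇒≡ {suc N} {a} {b} eq ag   = dist≡0⇒≡ (m+n≡0⇒m≡0 _ eq) ag′
  where
  ag′ : Agree N a b
  ag′ i N≤i with N ℕ.≟ i
  ... | yes refl = ne≡0 (a i) (b i) (m+n≡0⇒n≡0 (dist N a b) eq)
  ... | no  N≢i  = ag i (≤∧≢⇒< N≤i N≢i)

-- Double counting along geodesics

flip : Seq → ℕ → Seq
flip T i j with j ℕ.≟ i
... | yes _ = opposite (T j)
... | no  _ = T j

flip-at : ∀ T i → flip T i i ≡ opposite (T i)
flip-at T i with i ℕ.≟ i
... | yes _   = refl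
... | no  i≢i = contradiction refl i≢i

flip-off : ∀ T {i j} → j ≢ i → flip T i j ≡ T j
flip-off T {i} {j} j≢i with j ℕ.≟ i
... | yes j≡i = contradiction j≡i j≢i
... | no  _   = refl

-- Here τ = dist(T,c), r = dist(a,T), ξ = dist(x,c), D = dist(x,T), E = dist(x,a), n = 2d - τ;
-- q counts the i with Tᵢ = cᵢ ≠ xᵢ and g those with aᵢ = xᵢ ≠ Tᵢ.  So a random coordinate counted
-- by q moves T towards a with probability at least r/n.
gain-ratio : ∀ {d τ n r g q ξ D E} → τ + n ≡ d + d → τ + r ≤ d → ξ ≤ d → d ≤ D → E ≤ d →
             E + 2 * g ≡ D + r → 2 * q + τ ≡ ξ + D → r * q ≤ n * g
gain-ratio {d} {τ} {n} {r} {g} {q} {ξ} {D} {E} τ+n τ+r≤d ξ≤d d≤D E≤d eq-g eq-q =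
  *-cancelˡ-≤ 2 (begin
    2 * (r * q)        ≡⟨ x∙yz r q ⟩
    r * (2 * q)        ≤⟨ *-monoʳ-≤ r 2q≤ ⟩
    r * (n + z)        ≡⟨ *-distribˡ-+ r n z ⟩
    r * n + r * z      ≤⟨ +-monoʳ-≤ (r * n) (*-monoˡ-≤ z r≤n) ⟩
    r * n + n * z      ≡⟨ swap r n z ⟩
    n * (z + r)        ≤⟨ *-monoʳ-≤ n 2g≥ ⟩
    n * (2 * g)        ≡⟨ sym (x∙yz n g) ⟩
    2 * (n * g)        ∎)
  where
  open ≤-Reasoning
  -- The overshoot of `x` past distance `d`. It enters both estimates, 2q ≤ n + z and z + r ≤ 2g,
  -- and `r≤n` lets it be traded from one side to the other.
  z = D ∸ d
  d+z≡D : d + z ≡ D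
  d+z≡D = m+[n∸m]≡n d≤D
  x∙yz : ∀ r q → 2 * (r * q) ≡ r * (2 * q)
  x∙yz = solve-∀
  swap : ∀ r n z → r * n + n * z ≡ n * (z + r)
  swap = solve-∀
  r≤n : r ≤ n
  r≤n = +-cancelˡ-≤ τ r n (≤-trans τ+r≤d (≤-trans (m≤m+n d d) (≤-reflexive (sym τ+n))))
  2g≥ : z + r ≤ 2 * g
  2g≥ = +-cancelˡ-≤ d (z + r) (2 * g) (begin
    d + (z + r)  ≡⟨ sym (+-assoc d z r) ⟩
    d + z + r    ≡⟨ cong (_+ r) d+z≡D ⟩
    D + r        ≡⟨ sym eq-g ⟩
    E + 2 * g    ≤⟨ +-monoˡ-≤ (2 * g) E≤d ⟩
    d + 2 * g    ∎)
  2q≤ : 2 * q ≤ n + z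
  2q≤ = +-cancelˡ-≤ τ (2 * q) (n + z) (begin
    τ + 2 * q    ≡⟨ +-comm τ (2 * q) ⟩
    2 * q + τ    ≡⟨ eq-q ⟩
    ξ + D        ≤⟨ +-monoˡ-≤ D ξ≤d ⟩
    d + D        ≡⟨ cong (d +_) (sym d+z≡D) ⟩
    d + (d + z)  ≡⟨ sym (+-assoc d d z) ⟩
    d + d + z    ≡⟨ cong (_+ z) (sym τ+n) ⟩
    τ + n + z    ≡⟨ +-assoc τ n z ⟩
    τ + (n + z)  ∎)

-- The elements to be counted: `T` has been moved part of the way from `c` to each of them, and `r`
-- flips remain.
record Above (S : SeqSet) (c T : Seq) (N r : ℕ) (a : Seq) : Set where
  constructor above
  field
    member  : S a
    between : Between c T a
    agree   : Agree N a c
    remains : dist N a T ≡ r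

open Above

sum-ne≡length-filter : ∀ (t : Fin 2) i (xs : List Seq) →
  sum (map (λ a → ne (a i) t) xs) ≡ length (filter (λ a → ¬? (a i ≟ t)) xs)
sum-ne≡length-filter t i []       = refl
sum-ne≡length-filter t i (a ∷ xs) with a i ≟ t
... | yes a≡t = trans (cong (_+ sum (map (λ a → ne (a i) t) xs)) (ne-≡ a≡t)) (sum-ne≡length-filter t i xs)
... | no  a≢t = cong₂ _+_ (ne-≢ a≢t) (sum-ne≡length-filter t i xs)

module _ {S : SeqSet} {d : ℕ}
         (close : ∀ a b → S a → S b → DistLe a b d)
         (far : ∀ T → ¬ ¬ (Σ Seq λ x → S x × DistGe x T d)) where

  -- Induction on `r`, where `n` is 2d - τ. Flipping `T` at a coordinate counted by `q` lowers `n`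
  -- by one, and lowers `r` by one for the elements that differ from `T` there, so the induction
  -- hypothesis bounds every column of the incidence table. `gain-ratio` bounds every row from
  -- below, and comparing the totals gives the claim.
  count≤C : ∀ r n N {c T} xs → S c → Agree N T c → dist N T c + n ≡ d + d →
            All (Above S c T N r) xs → AllPairs Distinct xs → length xs ≤ n C r
  count≤C r       n N []           _  _   _   _           _                      = z≤n
  count≤C zero    n N (a ∷ [])     _  _   _   _           _                      = ≤-refl
  count≤C zero    n N (a ∷ b ∷ xs) _  agT _   (pa ∷ pb ∷ _) (((i , a≢b) ∷ _) ∷ _) =
    contradiction (trans (eq pa) (sym (eq pb))) a≢b
    where
    eq : ∀ {a} → Above S _ _ N 0 a → a i ≡ _
    eq p = dist≡0⇒≡ (remains p) (Agree-trans (agree p) (Agree-sym agT)) i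
  count≤C (suc r) n N {c} {T} xs@(_ ∷ _) Sc agT τ+n ps distinct =
    decidable-stable (length xs ≤? n C suc r) λ fails →
    far T λ (x , Sx , x-far) →
    DistLe⇒Agree (close x c Sx Sc) λ (M , ag) →
    fails (step x Sx x-far (N ⊔ M) (m≤m⊔n N M) (Agree-mono (m≤n⊔m N M) ag))
    where
    -- `x` may differ from `c` outside the window `N`. All is restated over a larger window `K`,
    -- which leaves the distances among `T`, `c` and the listed elements unchanged.
    step : ∀ x → S x → DistGe x T d → ∀ K → N ≤ K → Agree K x c → length xs ≤ n C suc r
    step x Sx x-far K N≤K agx = bound n refl
      where
      open ≤-Reasoning
      agT′ : Agree K T c
      agT′ = Agree-mono N≤K agT
      rewindow : ∀ {a} → Above S c T N (suc r) a → Above S c T K (suc r) a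
      rewindow (above s b ag rem) = above s b (Agree-mono N≤K ag)
        (trans (dist-extend N≤K (Agree-trans ag (Agree-sym agT))) rem)
      τ+n′ : dist K T c + n ≡ d + d
      τ+n′ = trans (cong (_+ n) (dist-extend N≤K agT)) τ+n
      ps′ : All (Above S c T K (suc r)) xs
      ps′ = All.map rewindow ps
      q : ℕ → ℕ
      q i = ne (x i) (c i) * ne (x i) (T i)
      Q : ℕ
      Q = Σ< K q
      g : Seq → ℕ → ℕ
      g a i = ne (x i) (T i) * ne (a i) (T i)
      d≤D : d ≤ dist K x T
      d≤D = DistGe⇒≤dist x-far (Agree-trans agx (Agree-sym agT′))
      τ+r≤d : ∀ {a} → Above S c T K (suc r) a → dist K T c + suc r ≤ d
      τ+r≤d {a} p = begin
        dist K T c + suc r        ≡⟨ cong (dist K T c +_) (sym (remains p)) ⟩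
        dist K T c + dist K a T   ≡⟨ dist-between {K} (between p) ⟩
        dist K a c                ≤⟨ DistLe⇒dist≤ (close a c (member p) Sc) K ⟩
        d                         ∎
      ratio : ∀ {a} → Above S c T K (suc r) a → suc r * Q ≤ n * Σ< K (g a)
      ratio {a} p = gain-ratio {E = dist K x a} τ+n′ (τ+r≤d p)
        (DistLe⇒dist≤ (close x c Sx Sc) K) d≤D (DistLe⇒dist≤ (close x a Sx (member p)) K)
        (trans (dist-parallelogram K x a T) (cong (dist K x T +_) (remains p)))
        (dist-median K x c T)
      g≤q : ∀ {a} → Above S c T K (suc r) a → Σ< K (g a) ≤ Q
      g≤q {a} p = Σ<-mono K λ i _ → begin
        g a i                  ≡⟨ ne-gain (x i) (between p i) ⟩
        q i * ne (a i) (T i)   ≤⟨ *-monoʳ-≤ (q i) (ne≤1 (a i) (T i)) ⟩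
        q i * 1                ≡⟨ *-identityʳ (q i) ⟩
        q i                    ∎
      -- `Q` has to be cancelled at the end. As `x` is at least `d` from `T` but at most `d` from
      -- `a`, an element with flips remaining has a coordinate counted by `g`, hence one counted by
      -- `q`.
      Q>0 : 0 < Q
      Q>0 = ≤-trans (n≢0⇒n>0 g≢0) (g≤q p)
        where
        p = All.head ps′
        a = _
        g≢0 : Σ< K (g a) ≢ 0
        g≢0 g≡0 = <⇒≱ (s≤s z≤n) (begin
          suc r   ≤⟨ +-cancelˡ-≤ d (suc r) 0 (begin
              d + suc r                         ≤⟨ +-monoˡ-≤ (suc r) d≤D ⟩
              dist K x T + suc r                ≡⟨ cong (dist K x T +_) (sym (remains p)) ⟩
              dist K x T + dist K a T           ≡⟨ sym (dist-parallelogram K x a T) ⟩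
              dist K x a + 2 * Σ< K (g a)       ≡⟨ cong (λ z → dist K x a + 2 * z) g≡0 ⟩
              dist K x a + 0                    ≤⟨ +-monoˡ-≤ 0 (DistLe⇒dist≤ (close x a Sx (member p)) K) ⟩
              d + 0                             ∎) ⟩
          0       ∎)
      moves? : ∀ i (a : Seq) → Dec (a i ≢ T i)
      moves? i a = ¬? (a i ≟ T i)
      through : ℕ → List Seq
      through i = filter (moves? i) xs
      bound : ∀ m → m ≡ n → length xs ≤ n C suc r
      -- Here τ would be 2d, which contradicts τ + r + 1 ≤ d.
      bound zero    refl = contradiction
        (≤-trans (τ+r≤d (All.head ps′)) (≤-trans (m≤m+n d d) (≤-reflexive (sym τ+n′))))
        (<⇒≱ (+-monoʳ-< (dist K T c) (s≤s z≤n)))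
      bound (suc m) refl = *-cancelˡ-≤ (suc r * Q) {{>-nonZero (*-mono-≤ {1} {suc r} (s≤s z≤n) Q>0)}} (begin
        suc r * Q * length xs                       ≡⟨ *-comm (suc r * Q) (length xs) ⟩
        length xs * (suc r * Q)                     ≡⟨ sym (sum-map-const (suc r * Q) xs) ⟩
        sum (map (λ _ → suc r * Q) xs)              ≤⟨ sum-map-mono xs (All.map ratio ps′) ⟩
        sum (map (λ a → suc m * Σ< K (g a)) xs)     ≡⟨ sum-map-*ˡ (suc m) (λ a → Σ< K (g a)) xs ⟩
        suc m * sum (map (λ a → Σ< K (g a)) xs)     ≤⟨ *-monoʳ-≤ (suc m) total ⟩
        suc m * (Q * (m C r))                       ≡⟨ front (suc m) Q (m C r) ⟩
        Q * (suc m * (m C r))                       ≡⟨ cong (Q *_) (sym (C-absorption m r)) ⟩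
        Q * (suc r * (suc m C suc r))               ≡⟨ assoc Q (suc r) (suc m C suc r) ⟩
        suc r * Q * (suc m C suc r)                 ∎)
        where
        front : ∀ a b c → a * (b * c) ≡ b * (a * c)
        front = solve-∀
        assoc : ∀ a b c → a * (b * c) ≡ b * a * c
        assoc = solve-∀
        advance : ∀ {i} → i < K → T i ≡ c i → length (through i) ≤ m C r
        advance {i} i<K T≡c = count≤C r m K (through i) Sc agFlip τ+m
          (All.zipWith raise (AllP.filter⁺ (moves? i) ps′ , AllP.all-filter (moves? i) xs))
          (AllPairsP.filter⁺ (moves? i) distinct)
          where
          agFlip : Agree K (flip T i) c
          agFlip j K≤j = trans (flip-off T (λ { refl → <⇒≱ i<K K≤j })) (agT′ j K≤j)
          -- `T` agreed with `c` at `i`, so the flip adds one to τ and `suc m` drops to `m`.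
          τ+m : dist K (flip T i) c + m ≡ d + d
          τ+m = trans (cong (_+ m) (Σ<-bump K {i = i} i<K (λ j j≢i → cong (λ t → ne t (c j)) (flip-off T j≢i))
                  (trans (cong₂ ne (flip-at T i) (sym T≡c))
                    (trans (ne-≢ (opposite-≢ (T i))) (cong suc (sym (ne-≡ T≡c)))))))
                  (trans (sym (+-suc _ m)) τ+n′)
          raise : ∀ {a} → Above S c T K (suc r) a × (a i ≢ T i) → Above S c (flip T i) K r a
          raise {a} (p , a≢T) = above (member p) btw (agree p) rem
            where
            flip≡a : flip T i i ≡ a i
            flip≡a = trans (flip-at T i) (≢-opposite (a≢T ∘ sym))
            btw : Between c (flip T i) a
            btw j with j ℕ.≟ i
            ... | yes refl = inj₂ (≢-opposite (a≢T ∘ sym))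
            ... | no  _    = between p j
            rem : dist K a (flip T i) ≡ r
            rem = suc-injective (trans (sym (Σ<-bump K {i = i} i<K
              (λ j j≢i → cong (ne (a j)) (sym (flip-off T j≢i)))
              (trans (ne-≢ a≢T) (cong suc (sym (ne-≡ (sym flip≡a))))))) (remains p))
        total : sum (map (λ a → Σ< K (g a)) xs) ≤ Q * (m C r)
        total = begin
          sum (map (λ a → Σ< K (g a)) xs)
            ≤⟨ sum-map-mono xs (All.map (λ p → ≤-reflexive (Σ<-cong K (λ i → ne-gain (x i) (between p i)))) ps′) ⟩
          sum (map (λ a → Σ< K (λ i → q i * ne (a i) (T i))) xs)
            ≡⟨ sum-Σ<-swap K (λ a i → q i * ne (a i) (T i)) xs ⟩
          Σ< K (λ i → sum (map (λ a → q i * ne (a i) (T i)) xs))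
            ≡⟨ Σ<-cong K (λ i → trans (sum-map-*ˡ (q i) _ xs)
                                      (cong (q i *_) (sum-ne≡length-filter (T i) i xs))) ⟩
          Σ< K (λ i → q i * length (through i))
            ≤⟨ Σ<-mono K column ⟩
          Σ< K (λ i → q i * (m C r))
            ≡⟨ Σ<-*ʳ K (m C r) q ⟩
          Q * (m C r) ∎
          where
          column : ∀ i → i < K → q i * length (through i) ≤ q i * (m C r)
          column i i<K with ne-both (x i) (c i) (T i)
          ... | inj₁ q≡0 rewrite q≡0 = z≤n
          ... | inj₂ T≡c = *-monoʳ-≤ (q i) (advance i<K T≡c)

-- Traces and the Sauer–Shelah lemma

Σᵛ : ∀ n → (Vec (Fin 2) n → ℕ) → ℕ
Σᵛ zero    f = f []
Σᵛ (suc n) f = Σᵛ n (λ p → f (zero ∷ p)) + Σᵛ n (λ p → f (suc zero ∷ p))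

Σᵛ-cong : ∀ n {f g} → (∀ p → f p ≡ g p) → Σᵛ n f ≡ Σᵛ n g
Σᵛ-cong zero    h = h []
Σᵛ-cong (suc n) h = cong₂ _+_ (Σᵛ-cong n (λ p → h (zero ∷ p))) (Σᵛ-cong n (λ p → h (suc zero ∷ p)))

Σᵛ-mono : ∀ n {f g} → (∀ p → f p ≤ g p) → Σᵛ n f ≤ Σᵛ n g
Σᵛ-mono zero    h = h []
Σᵛ-mono (suc n) h = +-mono-≤ (Σᵛ-mono n (λ p → h (zero ∷ p))) (Σᵛ-mono n (λ p → h (suc zero ∷ p)))

Σᵛ-+ : ∀ n f g → Σᵛ n (λ p → f p + g p) ≡ Σᵛ n f + Σᵛ n g
Σᵛ-+ zero    f g = refl
Σᵛ-+ (suc n) f g = trans (cong₂ _+_ (Σᵛ-+ n (λ p → f (zero ∷ p)) (λ p → g (zero ∷ p)))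
                                     (Σᵛ-+ n (λ p → f (suc zero ∷ p)) (λ p → g (suc zero ∷ p))))
  (shuffle (Σᵛ n (λ p → f (zero ∷ p))) (Σᵛ n (λ p → g (zero ∷ p)))
           (Σᵛ n (λ p → f (suc zero ∷ p))) (Σᵛ n (λ p → g (suc zero ∷ p))))
  where
  shuffle : ∀ a b c e → (a + b) + (c + e) ≡ (a + c) + (b + e)
  shuffle = solve-∀

Σᵛ-*ʳ : ∀ n f k → Σᵛ n (λ p → f p * k) ≡ Σᵛ n f * k
Σᵛ-*ʳ zero    f k = refl
Σᵛ-*ʳ (suc n) f k = trans (cong₂ _+_ (Σᵛ-*ʳ n _ k) (Σᵛ-*ʳ n _ k)) (sym (*-distribʳ-+ k (Σᵛ n _) _))

Σᵛ-const : ∀ n k → Σᵛ n (λ _ → k) ≡ 2 ^ n * k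
Σᵛ-const zero    k = sym (+-identityʳ k)
Σᵛ-const (suc n) k = trans (cong₂ _+_ (Σᵛ-const n k) (Σᵛ-const n k)) (double (2 ^ n) k)
  where
  double : ∀ a k → a * k + a * k ≡ 2 * a * k
  double = solve-∀

term≤Σᵛ : ∀ {n} f (p : Vec (Fin 2) n) → f p ≤ Σᵛ n f
term≤Σᵛ f []             = ≤-refl
term≤Σᵛ f (zero ∷ p)     = ≤-trans (term≤Σᵛ (λ p → f (zero ∷ p)) p) (m≤m+n _ _)
term≤Σᵛ f (suc zero ∷ p) = ≤-trans (term≤Σᵛ (λ p → f (suc zero ∷ p)) p) (m≤n+m _ _)

toℕ : Bool → ℕ
toℕ false = 0
toℕ true  = 1

toℕ-∨-∧ : ∀ x y → toℕ x + toℕ y ≡ toℕ (x ∨ y) + toℕ (x ∧ y)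
toℕ-∨-∧ false y     = sym (+-identityʳ _)
toℕ-∨-∧ true  false = refl
toℕ-∨-∧ true  true  = refl

size : ∀ {n} → (Vec (Fin 2) n → Bool) → ℕ
size {n} P = Σᵛ n (λ p → toℕ (P p))

trace : (is : List ℕ) → Seq → Vec (Fin 2) (length is)
trace []       a = []
trace (i ∷ is) a = a i ∷ trace is a

trace-≡ : ∀ is {a b} → trace is a ≡ trace is b → All (λ i → a i ≡ b i) is
trace-≡ []       _  = []
trace-≡ (i ∷ is) eq = ∷-injectiveˡ eq ∷ trace-≡ is (∷-injectiveʳ eq)

-- Shattering of `js` without a projection from patterns on `is` to patterns on `js`: the
-- restriction of `p` is read off from the sequences whose trace is `p`. The prescribed pattern is
-- given by a whole sequence `b`, so that the opposite of a member can be used directly.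
Shatters : (is : List ℕ) → ℕ → (Vec (Fin 2) (length is) → Bool) → Set
Shatters is s P = Σ (List ℕ) λ js → js ⊆ is × length js ≡ s ×
  (∀ (b : Seq) → Σ (Vec (Fin 2) (length is)) λ p → P p ≡ true ×
     (∀ a → trace is a ≡ p → All (λ j → a j ≡ b j) js))

size≤0⊎nonempty : ∀ n (P : Vec (Fin 2) n → Bool) → size P ≤ 0 ⊎ Σ _ λ p → P p ≡ true
size≤0⊎nonempty zero P with P [] in eq
... | false = inj₁ z≤n
... | true  = inj₂ ([] , eq)
size≤0⊎nonempty (suc n) P
  with size≤0⊎nonempty n (λ p → P (zero ∷ p)) | size≤0⊎nonempty n (λ p → P (suc zero ∷ p))
... | inj₂ (p , Pp) | _             = inj₂ (zero ∷ p , Pp)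
... | inj₁ _        | inj₂ (p , Pp) = inj₂ (suc zero ∷ p , Pp)
... | inj₁ le₀      | inj₁ le₁      = inj₁ (+-mono-≤ le₀ le₁)

∨-true : ∀ x y → x ∨ y ≡ true → x ≡ true ⊎ y ≡ true
∨-true true  y _  = inj₁ refl
∨-true false y eq = inj₂ eq

∧-true : ∀ x y → x ∧ y ≡ true → x ≡ true × y ≡ true
∧-true true true _ = refl , refl

-- Split at the first coordinate. The projection `either` and the link `both` have sizes adding up
-- to that of `P`, matching the recursion of `Φ`. A set shattered by `either` is shattered by `P`;
-- one shattered by `both` can be enlarged by `i`.
sauer-shelah : ∀ is s P → size P ≤ Φ (length is) s ⊎ Shatters is s P
sauer-shelah is zero P with size≤0⊎nonempty (length is) P
... | inj₁ le       = inj₁ le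
... | inj₂ (p , Pp) = inj₂ ([] , []⊆-universal is , refl , λ _ → p , Pp , λ _ _ → [])
sauer-shelah [] (suc s) P with P []
... | false = inj₁ z≤n
... | true  = inj₁ ≤-refl
sauer-shelah (i ∷ is) (suc s) P = combine (sauer-shelah is (suc s) either) (sauer-shelah is s both)
  where
  P₀ P₁ either both : Vec (Fin 2) (length is) → Bool
  P₀ p = P (zero ∷ p)
  P₁ p = P (suc zero ∷ p)
  either p = P₀ p ∨ P₁ p
  both p = P₀ p ∧ P₁ p
  sizes : size P ≡ size either + size both
  sizes = trans (sym (Σᵛ-+ (length is) (toℕ ∘ P₀) (toℕ ∘ P₁)))
         (trans (Σᵛ-cong (length is) (λ p → toℕ-∨-∧ (P₀ p) (P₁ p)))
                (Σᵛ-+ (length is) (toℕ ∘ either) (toℕ ∘ both)))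
  extend : ∀ p → both p ≡ true → ∀ x → P (x ∷ p) ≡ true
  extend p eq zero       = proj₁ (∧-true (P₀ p) (P₁ p) eq)
  extend p eq (suc zero) = proj₂ (∧-true (P₀ p) (P₁ p) eq)
  combine : size either ≤ Φ (length is) (suc s) ⊎ Shatters is (suc s) either →
            size both ≤ Φ (length is) s ⊎ Shatters is s both →
            size P ≤ Φ (suc (length is)) (suc s) ⊎ Shatters (i ∷ is) (suc s) P
  combine (inj₁ le) (inj₁ le′) = inj₁ (≤-trans (≤-reflexive sizes) (+-mono-≤ le le′))
  combine (inj₂ (js , js⊆is , len , hit)) _ = inj₂ (js , i ∷ʳ js⊆is , len , hit′)
    where
    hit′ : ∀ b → Σ _ λ p → P p ≡ true × (∀ a → trace (i ∷ is) a ≡ p → All (λ j → a j ≡ b j) js)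
    hit′ b with hit b
    ... | p , eq , on with ∨-true (P₀ p) (P₁ p) eq
    ...   | inj₁ eq₀ = zero ∷ p , eq₀ , λ a tr → on a (∷-injectiveʳ tr)
    ...   | inj₂ eq₁ = suc zero ∷ p , eq₁ , λ a tr → on a (∷-injectiveʳ tr)
  combine (inj₁ _) (inj₂ (js , js⊆is , len , hit)) = inj₂ (i ∷ js , refl ∷ js⊆is , cong suc len , hit′)
    where
    hit′ : ∀ b → Σ _ λ p → P p ≡ true × (∀ a → trace (i ∷ is) a ≡ p → All (λ j → a j ≡ b j) (i ∷ js))
    hit′ b with hit b
    ... | p , eq , on = b i ∷ p , extend p eq (b i) , λ a tr → ∷-injectiveˡ tr ∷ on a (∷-injectiveʳ tr)

trace? : ∀ is p (a : Seq) → Dec (trace is a ≡ p)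
trace? is p a = ≡-dec _≟_ (trace is a) p

fibre : ∀ is → Vec (Fin 2) (length is) → List Seq → List Seq
fibre is p = filter (trace? is p)

length≤Σ-fibres : ∀ is xs → length xs ≤ Σᵛ (length is) (λ p → length (fibre is p xs))
length≤Σ-fibres is []       = z≤n
length≤Σ-fibres is (a ∷ xs) = begin
  suc (length xs)
    ≤⟨ +-mono-≤ (≤-trans single (term≤Σᵛ (λ p → length (fibre is p (a ∷ []))) (trace is a))) (length≤Σ-fibres is xs) ⟩
  Σᵛ (length is) (λ p → length (fibre is p (a ∷ []))) + Σᵛ (length is) (λ p → length (fibre is p xs))
    ≡⟨ sym (Σᵛ-+ (length is) _ _) ⟩
  Σᵛ (length is) (λ p → length (fibre is p (a ∷ [])) + length (fibre is p xs))
    ≡⟨ Σᵛ-cong (length is) cons ⟩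
  Σᵛ (length is) (λ p → length (fibre is p (a ∷ xs))) ∎
  where
  open ≤-Reasoning
  single : 1 ≤ length (fibre is (trace is a) (a ∷ []))
  single with trace? is (trace is a) a
  ... | yes _ = ≤-refl
  ... | no  ≢ = contradiction refl ≢
  cons : ∀ p → length (fibre is p (a ∷ [])) + length (fibre is p xs) ≡ length (fibre is p (a ∷ xs))
  cons p with trace? is p a
  ... | yes _ = refl
  ... | no  _ = refl

nonempty : List Seq → Bool
nonempty []      = false
nonempty (_ ∷ _) = true

realised : ∀ is → List Seq → Vec (Fin 2) (length is) → Bool
realised is xs p = nonempty (fibre is p xs)

length≤size*k : ∀ is k xs → (∀ p → length (fibre is p xs) ≤ k) → length xs ≤ size (realised is xs) * k
length≤size*k is k xs bound = begin
  length xs                                                      ≤⟨ length≤Σ-fibres is xs ⟩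
  Σᵛ (length is) (λ p → length (fibre is p xs))                  ≤⟨ Σᵛ-mono (length is) (λ p → weaken (fibre is p xs) (bound p)) ⟩
  Σᵛ (length is) (λ p → toℕ (realised is xs p) * k)              ≡⟨ Σᵛ-*ʳ (length is) _ k ⟩
  size (realised is xs) * k                                      ∎
  where
  open ≤-Reasoning
  weaken : ∀ ys → length ys ≤ k → length ys ≤ toℕ (nonempty ys) * k
  weaken []      _  = z≤n
  weaken (_ ∷ _) le = ≤-trans le (≤-reflexive (sym (+-identityʳ k)))

realised⇒∃ : ∀ {Q : Seq → Set} is xs p → All Q xs → realised is xs p ≡ true →
             Σ Seq λ a → Q a × trace is a ≡ p
realised⇒∃ is xs p Qs eq
  with fibre is p xs | AllP.all-filter (trace? is p) xs | AllP.filter⁺ (trace? is p) Qs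
... | a ∷ _ | tr ∷ _ | Qa ∷ _ = a , Qa , tr

-- Counting all elements beyond an intermediate point

module _ {S : SeqSet} {d : ℕ}
         (close : ∀ a b → S a → S b → DistLe a b d)
         (far : ∀ T → ¬ ¬ (Σ Seq λ x → S x × DistGe x T d)) where

  -- Layer by layer in the remaining distance: `count≤C` bounds the outermost layer and `Φ-suc` adds
  -- it on.
  count≤Φ : ∀ R n N {c T} xs → S c → Agree N T c → dist N T c + n ≡ d + d →
            All (λ a → Σ ℕ λ r → r < R × Above S c T N r a) xs → AllPairs Distinct xs →
            length xs ≤ Φ n R
  count≤Φ zero    n N []       Sc agT τ+n ps distinct = z≤n
  count≤Φ zero    n N (_ ∷ _)  _  _   _   ((_ , () , _) ∷ _) _
  count≤Φ (suc R) n N {c} {T} xs Sc agT τ+n ps distinct = begin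
    length xs                                      ≡⟨ length-filter-split last? xs ⟩
    length (filter (¬? ∘ last?) xs) + length (filter last? xs)
      ≤⟨ +-mono-≤ (count≤Φ R n N _ Sc agT τ+n
                    (All.zipWith lower (AllP.all-filter (¬? ∘ last?) xs , AllP.filter⁺ (¬? ∘ last?) ps))
                    (AllPairsP.filter⁺ (¬? ∘ last?) distinct))
                  (count≤C close far R n N _ Sc agT τ+n
                    (All.zipWith exact (AllP.all-filter last? xs , AllP.filter⁺ last? ps))
                    (AllPairsP.filter⁺ last? distinct)) ⟩
    Φ n R + n C R                                  ≡⟨ sym (Φ-suc n R) ⟩
    Φ n (suc R)                                    ∎
    where
    open ≤-Reasoning
    last? : ∀ a → Dec (dist N a T ≡ R)
    last? a = dist N a T ℕ.≟ R
    lower : ∀ {a} → dist N a T ≢ R × (Σ ℕ λ r → r < suc R × Above S c T N r a) →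
            Σ ℕ λ r → r < R × Above S c T N r a
    lower (≢R , r , r<1+R , p) = r , ≤∧≢⇒< (s≤s⁻¹ r<1+R) (λ { refl → ≢R (remains p) }) , p
    exact : ∀ {a} → dist N a T ≡ R × (Σ ℕ λ r → r < suc R × Above S c T N r a) → Above S c T N R a
    exact (≡R , r , _ , p) = above (member p) (between p) (agree p) ≡R

  -- A lower bound `t` for τ suffices because `Φ` is monotone. The head of the list lies beyond `T`,
  -- which gives τ ≤ d and makes the truncated subtraction exact.
  count-beyond : ∀ R t N {c T} a xs → S c → Agree N T c → t ≤ dist N T c →
    All (λ a → S a × Between c T a × Agree N a c × dist N a T < R) (a ∷ xs) →
    AllPairs Distinct (a ∷ xs) → length (a ∷ xs) ≤ Φ (d + d ∸ t) R
  count-beyond R t N {c} {T} a xs Sc agT t≤τ ps@((Sa , btw , _) ∷ _) distinct = begin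
    length (a ∷ xs)                ≤⟨ count≤Φ R (d + d ∸ dist N T c) N (a ∷ xs) Sc agT (m+[n∸m]≡n τ≤2d)
                                      (All.map (λ (S , btw , ag , lt) → _ , lt , above S btw ag refl) ps) distinct ⟩
    Φ (d + d ∸ dist N T c) R       ≤⟨ Φ-monoˡ R (∸-monoʳ-≤ (d + d) t≤τ) ⟩
    Φ (d + d ∸ t) R                ∎
    where
    open ≤-Reasoning
    τ≤2d : dist N T c ≤ d + d
    τ≤2d = begin
      dist N T c                ≤⟨ m≤m+n _ (dist N a T) ⟩
      dist N T c + dist N a T   ≡⟨ dist-between {N} btw ⟩
      dist N a c                ≤⟨ DistLe⇒dist≤ (close a c Sa Sc) N ⟩
      d                         ≤⟨ m≤m+n d d ⟩
      d + d                     ∎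

-- Elements with a common trace

AllPairs-resp-⊆ : ∀ {A : Set} {R : A → A → Set} {xs ys : List A} → xs ⊆ ys → AllPairs R ys → AllPairs R xs
AllPairs-resp-⊆ []         []       = []
AllPairs-resp-⊆ (y ∷ʳ s)   (_ ∷ ps) = AllPairs-resp-⊆ s ps
AllPairs-resp-⊆ (refl ∷ s) (p ∷ ps) = All-resp-⊆ s p ∷ AllPairs-resp-⊆ s ps

-- Where `c` and `u` differ, `a` differs from exactly one of them and `t` follows `a`; where they
-- agree, `t` stays with `c` and a deviation of `a` is counted against both ends.
ne-off-diameter : ∀ {c u a t} → (c ≡ u → t ≡ c) → (c ≢ u → t ≡ a) → ne a c + ne a u ≡ ne c u + 2 * ne a t
ne-off-diameter {c} {u} {a} {t} t≡c t≡a with c ≟ u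
... | yes refl rewrite t≡c refl | ne-≡ {c} refl = cong (ne a c +_) (sym (+-identityʳ _))
... | no  c≢u  rewrite t≡a c≢u | ne-≡ {a} refl = opposite-ends a c u c≢u
  where
  opposite-ends : ∀ a c u → c ≢ u → ne a c + ne a u ≡ ne c u + 0
  opposite-ends _          zero       zero       c≢u = contradiction refl c≢u
  opposite-ends zero       zero       (suc zero) _   = refl
  opposite-ends (suc zero) zero       (suc zero) _   = refl
  opposite-ends zero       (suc zero) zero       _   = refl
  opposite-ends (suc zero) (suc zero) zero       _   = refl
  opposite-ends _          (suc zero) (suc zero) c≢u = contradiction refl c≢u

splice : List ℕ → Seq → Seq → Seq
splice is a c i with i ∈? is
... | yes _ = a i
... | no  _ = c i

splice-in : ∀ {is} a c {i} → i ∈ is → splice is a c i ≡ a i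
splice-in {is} a c {i} i∈is with i ∈? is
... | yes _    = refl
... | no  i∉is = contradiction i∈is i∉is

splice-∉ : ∀ {is} a c {i} → ¬ i ∈ is → splice is a c i ≡ c i
splice-∉ {is} a c {i} i∉is with i ∈? is
... | yes i∈is = contradiction i∈is i∉is
... | no  _    = refl

splice-Agree : ∀ {N a c} is → Agree N a c → Agree N (splice is a c) c
splice-Agree is ag i N≤i with i ∈? is
... | yes _ = ag i N≤i
... | no  _ = refl

-- One intermediate point thus serves a whole fibre of the trace on `is`.
splice-Between : ∀ {is a b} c → All (λ i → b i ≡ a i) is → Between c (splice is a c) b
splice-Between {is} c b≡a i with i ∈? is
... | yes i∈is = inj₂ (sym (All.lookup b≡a i∈is))
... | no  _    = inj₁ refl

module _ {S : SeqSet} {d : ℕ}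
         (close : ∀ a b → S a → S b → DistLe a b d)
         (far : ∀ T → ¬ ¬ (Σ Seq λ x → S x × DistGe x T d)) where

  Near : ℕ → Seq → Seq → Set
  Near N c a = S a × Agree N a c

  -- Let `T` follow the fibre on `is` and `c` elsewhere. Summing `ne-off-diameter` gives d + 2
  -- dist(b,T) ≤ dist(b,c) + dist(b,u) ≤ 2d, so at most d/2 flips remain.
  diameter-fibre : ∀ {N c u is} → S c → S u → Agree N u c →
    Unique is → All (Differ c u) is → length is ≡ d →
    ∀ p xs → All (Near N c) xs → AllPairs Distinct xs → All (λ a → trace is a ≡ p) xs →
    length xs ≤ Φ (d + d) (suc (d / 2))
  diameter-fibre Sc Su agu uniq ds len p [] _ _ _ = z≤n
  diameter-fibre {N} {c} {u} {is} Sc Su agu uniq ds len p (a ∷ xs) near@((Sa , aga) ∷ _) distinct traces@(tra ∷ _) =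
    -- The fibre may agree with `c` on all of `is`, so 0 is the only bound available for τ. The
    -- `suc` is there because `Φ` counts sizes strictly below its last argument.
    count-beyond close far (suc (d / 2)) 0 N a xs Sc (splice-Agree is aga) z≤n
      (All.zipWith enter (near , traces)) distinct
    where
    open ≤-Reasoning
    T : Seq
    T = splice is a c
    -- `is` already has `d` entries; another difference would exceed the diameter.
    complete : ∀ {i} → c i ≢ u i → i ∈ is
    complete {i} c≢u with i ∈? is
    ... | yes i∈is = i∈is
    ... | no  i∉is = contradiction
      (close c u Sc Su (i ∷ is) (AllP.¬Any⇒All¬ is i∉is ∷ uniq) (c≢u ∷ ds)) (<⇒≱ (s≤s (≤-reflexive (sym len))))
    enter : ∀ {b} → Near N c b × trace is b ≡ p → S b × Between c T b × Agree N b c × dist N b T < suc (d / 2)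
    enter {b} ((Sb , agb) , trb) = Sb , splice-Between c b≡a , agb , s≤s half
      where
      b≡a : All (λ i → b i ≡ a i) is
      b≡a = trace-≡ is (trans trb (sym tra))
      off : ∀ i → ne (b i) (c i) + ne (b i) (u i) ≡ ne (c i) (u i) + 2 * ne (b i) (T i)
      off i = ne-off-diameter
        (λ c≡u → splice-∉ a c (λ i∈is → All.lookup ds i∈is c≡u))
        (λ c≢u → trans (splice-in a c (complete c≢u)) (sym (All.lookup b≡a (complete c≢u))))
      sums : dist N b c + dist N b u ≡ dist N c u + 2 * dist N b T
      sums = trans (sym (Σ<-+ N _ _)) (trans (Σ<-cong N off) (trans (Σ<-+ N _ _)
               (cong (dist N c u +_) (Σ<-*ˡ N 2 _))))
      2r≤d : 2 * dist N b T ≤ d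
      2r≤d = +-cancelˡ-≤ d _ _ (begin
        d + 2 * dist N b T           ≤⟨ +-monoˡ-≤ _ (DistGe⇒≤dist (is , uniq , ds , len) (Agree-sym agu)) ⟩
        dist N c u + 2 * dist N b T  ≡⟨ sym sums ⟩
        dist N b c + dist N b u      ≤⟨ +-mono-≤ (DistLe⇒dist≤ (close b c Sb Sc) N) (DistLe⇒dist≤ (close b u Sb Su) N) ⟩
        d + d                        ∎)
      half : dist N b T ≤ d / 2
      half = begin
        dist N b T               ≡⟨ sym (m*n/n≡m (dist N b T) 2) ⟩
        dist N b T * 2 / 2       ≤⟨ /-monoˡ-≤ 2 (≤-trans (≤-reflexive (*-comm (dist N b T) 2)) 2r≤d) ⟩
        d / 2                    ∎

  -- The fibre has a single trace on `js`, so one `c′` is opposite to all its elements there. Taken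
  -- as the new centre, with `T` following the fibre on `js`, it makes τ at least `length js` and
  -- leaves at most `d ∸ length js` flips.
  shattered-fibre : ∀ {N c js} → Unique js →
    (∀ b → Σ Seq λ c′ → Near N c c′ × All (λ j → c′ j ≡ b j) js) →
    ∀ p xs → All (Near N c) xs → AllPairs Distinct xs → All (λ a → trace js a ≡ p) xs →
    length xs ≤ Φ (d + d ∸ length js) (suc (d ∸ length js))
  shattered-fibre uniq hit p [] _ _ _ = z≤n
  shattered-fibre {N} {c} {js} uniq hit p (a ∷ xs) near@((Sa , aga) ∷ _) distinct traces@(tra ∷ _)
    with hit (opposite ∘ a)
  ... | c′ , (Sc′ , agc′) , c′≡ =
    count-beyond close far (suc (d ∸ length js)) (length js) N a xs Sc′ agT s≤τ
      (All.zipWith enter (near , traces)) distinct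
    where
    open ≤-Reasoning
    T : Seq
    T = splice js a c′
    agT : Agree N T c′
    agT = splice-Agree js (Agree-trans aga (Agree-sym agc′))
    s≤τ : length js ≤ dist N T c′
    s≤τ = differ-length≤dist js uniq
      (All.tabulate λ {j} j∈js T≡c′ → opposite-≢ (a j)
        (trans (sym (All.lookup c′≡ j∈js)) (trans (sym T≡c′) (splice-in a c′ j∈js))))
      agT
    enter : ∀ {b} → Near N c b × trace js b ≡ p →
            S b × Between c′ T b × Agree N b c′ × dist N b T < suc (d ∸ length js)
    enter {b} ((Sb , agb) , trb) = Sb , btw , Agree-trans agb (Agree-sym agc′) , s≤s (begin
      dist N b T                                          ≡⟨ sym (m+n∸m≡n (dist N T c′) (dist N b T)) ⟩
      dist N T c′ + dist N b T ∸ dist N T c′              ≡⟨ cong (_∸ dist N T c′) (dist-between {N} btw) ⟩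
      dist N b c′ ∸ dist N T c′                           ≤⟨ ∸-mono (DistLe⇒dist≤ (close b c′ Sb Sc′) N) s≤τ ⟩
      d ∸ length js                                       ∎)
      where
      btw : Between c′ T b
      btw = splice-Between c′ (trace-≡ js (trans trb (sym tra)))

  fibres-bound : ∀ {N c} is k → 
    (∀ p xs → All (Near N c) xs → AllPairs Distinct xs → All (λ a → trace is a ≡ p) xs → length xs ≤ k) →
    ∀ xs → All (Near N c) xs → AllPairs Distinct xs → ∀ p → length (fibre is p xs) ≤ k
  fibres-bound is k bound xs near distinct p = bound p (fibre is p xs)
    (AllP.filter⁺ (trace? is p) near) (AllPairsP.filter⁺ (trace? is p) distinct) (AllP.all-filter (trace? is p) xs)

  card-dichotomy : ∀ {N c u} s → S c → S u → Agree N u c → DistGe c u d →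
    ∀ xs → All (Near N c) xs → AllPairs Distinct xs →
    length xs ≤ Φ d s * Φ (d + d) (suc (d / 2)) ⊎ length xs ≤ 2 ^ s * Φ (d + d ∸ s) (suc (d ∸ s))
  card-dichotomy {N} {c} s Sc Su agu (is , uniq , ds , len) xs near distinct
    with sauer-shelah is s (realised is xs)
  ... | inj₁ few = inj₁ (begin
    length xs                               ≤⟨ length≤size*k is k xs (fibres-bound is k
                                                 (diameter-fibre Sc Su agu uniq ds len) xs near distinct) ⟩
    size (realised is xs) * k               ≤⟨ *-monoˡ-≤ k few ⟩
    Φ (length is) s * k                     ≡⟨ cong (λ n → Φ n s * k) len ⟩
    Φ d s * k                               ∎)
    where
    open ≤-Reasoning
    k = Φ (d + d) (suc (d / 2))
  -- All patterns on `js` are summed over; shattering supplies an opposite centre for each of them.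
  ... | inj₂ (js , js⊆is , refl , shatter) = inj₂ (begin
    length xs                                              ≤⟨ length≤Σ-fibres js xs ⟩
    Σᵛ (length js) (λ p → length (fibre js p xs))          ≤⟨ Σᵛ-mono (length js) (fibres-bound js k
                                                               (shattered-fibre (AllPairs-resp-⊆ js⊆is uniq) hit) xs near distinct) ⟩
    Σᵛ (length js) (λ _ → k)                               ≡⟨ Σᵛ-const (length js) k ⟩
    2 ^ length js * k                                      ∎)
    where
    open ≤-Reasoning
    k = Φ (d + d ∸ length js) (suc (d ∸ length js))
    hit : ∀ b → Σ Seq λ c′ → Near N c c′ × All (λ j → c′ j ≡ b j) js
    hit b with shatter b
    ... | p , real , on with realised⇒∃ is xs p near real
    ...   | c′ , nearc′ , tr = c′ , nearc′ , on c′ tr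

common-window : ∀ {d c} xs → All (λ a → DistLe a c d) xs → ¬ ¬ (Σ ℕ λ N → All (λ a → Agree N a c) xs)
common-window []       []         k = k (0 , [])
common-window (a ∷ xs) (le ∷ les) k =
  DistLe⇒Agree le λ (M , ag) →
  common-window xs les λ (N , ags) →
  k (M ⊔ N , Agree-mono (m≤m⊔n M N) ag ∷ All.map (Agree-mono (m≤n⊔m M N)) ags)

-- Exponential estimates

^-distribʳ-* : ∀ a b n → (a * b) ^ n ≡ a ^ n * b ^ n
^-distribʳ-* a b zero    = refl
^-distribʳ-* a b (suc n) = trans (cong (a * b *_) (^-distribʳ-* a b n)) (shuffle a b (a ^ n) (b ^ n))
  where
  shuffle : ∀ a b x y → a * b * (x * y) ≡ a * x * (b * y)
  shuffle = solve-∀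

^-split : ∀ a k l s e → a ^ (k * s + l * e) ≡ (a ^ k) ^ s * (a ^ l) ^ e
^-split a k l s e = trans (^-distribˡ-+-* a (k * s) (l * e)) (cong₂ _*_ (sym (^-*-assoc a k s)) (sym (^-*-assoc a l e)))

-- The hypothesis on e is the case s = 10: from there on each further s gains, by the hypothesis
-- before it, so the constants and the powers indexed by e need not be compared separately.
cancel-growth : ∀ P K C₁ C₂ C₃ D₁ D₂ D₃ s e L →
  .{{NonZero C₁}} → .{{NonZero C₂}} → .{{NonZero C₃}} → 10 ≤ s →
  D₁ * P ^ 16 ≤ K ^ 16 * C₁ →
  (D₁ * P ^ 16) ^ 10 * ((D₂ * P ^ 1) ^ e * D₃) ≤ (K ^ 16 * C₁) ^ 10 * ((K ^ 1 * C₂) ^ e * C₃) →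
  L * (C₁ ^ s * (C₂ ^ e * C₃)) ≤ D₁ ^ s * (D₂ ^ e * D₃) →
  L * P ^ (16 * s + 1 * e) ≤ K ^ (16 * s + 1 * e)
cancel-growth P K C₁ C₂ C₃ D₁ D₂ D₃ s e L 10≤s rate initial bound =
  *-cancelʳ-≤ _ _ Z {{Z≢0}} (begin
    L * P ^ d * Z                         ≡⟨ swap L (P ^ d) Z ⟩
    L * Z * P ^ d                         ≤⟨ *-monoˡ-≤ (P ^ d) bound ⟩
    D₁ ^ s * (D₂ ^ e * D₃) * P ^ d        ≡⟨ gather D₁ D₂ D₃ P ⟩
    X ^ s * ((D₂ * P ^ 1) ^ e * D₃)       ≡⟨ peel X _ ⟩
    X ^ k * (X ^ 10 * ((D₂ * P ^ 1) ^ e * D₃)) ≤⟨ *-mono-≤ (^-monoˡ-≤ k rate) initial ⟩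
    Y ^ k * (Y ^ 10 * ((K ^ 1 * C₂) ^ e * C₃)) ≡⟨ sym (peel Y _) ⟩
    Y ^ s * ((K ^ 1 * C₂) ^ e * C₃)       ≡⟨ cong₂ (λ u v → u ^ s * (v ^ e * C₃)) (*-comm (K ^ 16) C₁) (*-comm (K ^ 1) C₂) ⟩
    (C₁ * K ^ 16) ^ s * ((C₂ * K ^ 1) ^ e * C₃) ≡⟨ sym (gather C₁ C₂ C₃ K) ⟩
    Z * K ^ d                             ≡⟨ *-comm Z (K ^ d) ⟩
    K ^ d * Z                             ∎)
  where
  open ≤-Reasoning
  d = 16 * s + 1 * e
  k = s ∸ 10
  Z = C₁ ^ s * (C₂ ^ e * C₃)
  X = D₁ * P ^ 16
  Y = K ^ 16 * C₁
  Z≢0 : NonZero Z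
  Z≢0 = m*n≢0 _ _ {{m^n≢0 C₁ s}} {{m*n≢0 _ _ {{m^n≢0 C₂ e}}}}
  swap : ∀ a b c → a * b * c ≡ a * c * b
  swap = solve-∀
  gather : ∀ u v w a → u ^ s * (v ^ e * w) * a ^ d ≡ (u * a ^ 16) ^ s * ((v * a ^ 1) ^ e * w)
  gather u v w a = begin-equality
    u ^ s * (v ^ e * w) * a ^ d
      ≡⟨ cong (u ^ s * (v ^ e * w) *_) (^-split a 16 1 s e) ⟩
    u ^ s * (v ^ e * w) * ((a ^ 16) ^ s * (a ^ 1) ^ e)
      ≡⟨ shuffle (u ^ s) (v ^ e) w ((a ^ 16) ^ s) ((a ^ 1) ^ e) ⟩
    u ^ s * (a ^ 16) ^ s * (v ^ e * (a ^ 1) ^ e * w)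
      ≡⟨ sym (cong₂ (λ x y → x * (y * w)) (^-distribʳ-* u (a ^ 16) s) (^-distribʳ-* v (a ^ 1) e)) ⟩
    (u * a ^ 16) ^ s * ((v * a ^ 1) ^ e * w) ∎
    where
    shuffle : ∀ a b c x y → a * (b * c) * (x * y) ≡ a * x * (b * y * c)
    shuffle = solve-∀
  peel : ∀ x y → x ^ s * y ≡ x ^ k * (x ^ 10 * y)
  peel x y = begin-equality
    x ^ s * y              ≡⟨ cong (λ n → x ^ n * y) (sym (m∸n+n≡m 10≤s)) ⟩
    x ^ (k + 10) * y       ≡⟨ cong (_* y) (^-distribˡ-+-* x k 10) ⟩
    x ^ k * x ^ 10 * y     ≡⟨ *-assoc (x ^ k) (x ^ 10) y ⟩
    x ^ k * (x ^ 10 * y)   ∎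

-- `Φ-tail` at odds 1 : 15 for the traces and 1 : 4 for the fibres. The optimum for the latter is 1
-- : 3, but 4 avoids square roots, since 4 ^ (d / 2) is at most 2 ^ d. The product grows like 3.95 ^
-- d.
few-traces-bound : ∀ s e L → 10 ≤ s → e < 16 → let d = 16 * s + 1 * e in
  L ≤ Φ d s * Φ (d + d) (suc (d / 2)) → L * (10 ^ 10) ^ d ≤ 39999999999 ^ d
few-traces-bound s e L 10≤s e<16 L≤ =
  -- 240 is 15 · 16 and 800 is 16 · 25 · 2, where 16 and 25 include the squares of 4 and 5 coming
  -- from the exponent 2d. The last 4 pays for the extra one in `suc (d / 2)`. The 16 residues `e`
  -- are checked by evaluation.
  cancel-growth (10 ^ 10) 39999999999 (240 ^ 16) (240 ^ 1) 1 (15 * 800 ^ 16) (800 ^ 1) 4 s e L 10≤s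
    (from-yes (15 * 800 ^ 16 * (10 ^ 10) ^ 16 ≤? 39999999999 ^ 16 * 240 ^ 16))
    (from-yes (allUpTo? (λ e → (15 * 800 ^ 16 * (10 ^ 10) ^ 16) ^ 10 * ((800 ^ 1 * (10 ^ 10) ^ 1) ^ e * 4)
       ≤? (39999999999 ^ 16 * 240 ^ 16) ^ 10 * ((39999999999 ^ 1 * 240 ^ 1) ^ e * 1)) 16) e<16)
    (begin
      L * ((240 ^ 16) ^ s * ((240 ^ 1) ^ e * 1))   ≡⟨ cong (L *_) (collect 240 1) ⟩
      L * (240 ^ d * 1)                            ≡⟨ cong (L *_) (*-identityʳ (240 ^ d)) ⟩
      L * 240 ^ d                                  ≤⟨ *-monoˡ-≤ (240 ^ d) L≤ ⟩
      f * g * 240 ^ d                              ≡⟨ cong (f * g *_) (^-distribʳ-* 15 16 d) ⟩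
      f * g * (15 ^ d * 16 ^ d)                    ≡⟨ units f g (15 ^ d) (16 ^ d) ⟩
      f * (1 * 15 ^ d) * (g * (1 * 16 ^ d))        ≡⟨ cong₂ _*_ (cong (λ z → f * (z * 15 ^ d)) (sym (^-zeroˡ s)))
                                                      (cong₂ (λ y z → g * (y * z)) (sym (^-zeroˡ (suc (d / 2)))) (double 4)) ⟩
      f * (1 ^ s * 15 ^ d) * (g * (1 ^ suc (d / 2) * 4 ^ (d + d)))
                                                   ≤⟨ *-mono-≤ (Φ-tail {1} {15} (s≤s z≤n) d s) (Φ-tail {1} {4} (s≤s z≤n) (d + d) (suc (d / 2))) ⟩
      16 ^ d * 15 ^ s * (5 ^ (d + d) * 4 ^ suc (d / 2))
                                                   ≤⟨ *-monoʳ-≤ (16 ^ d * 15 ^ s) (*-monoʳ-≤ (5 ^ (d + d)) (*-monoʳ-≤ 4 halves)) ⟩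
      16 ^ d * 15 ^ s * (5 ^ (d + d) * (4 * 2 ^ d)) ≡⟨ cong (λ z → 16 ^ d * 15 ^ s * (z * (4 * 2 ^ d))) (sym (double 5)) ⟩
      16 ^ d * 15 ^ s * (25 ^ d * (4 * 2 ^ d))     ≡⟨ regroup (16 ^ d) (15 ^ s) (25 ^ d) (2 ^ d) ⟩
      15 ^ s * (16 ^ d * 25 ^ d * 2 ^ d * 4)       ≡⟨ cong (λ z → 15 ^ s * (z * 4)) (sym (trans (^-distribʳ-* 400 2 d) (cong (_* 2 ^ d) (^-distribʳ-* 16 25 d)))) ⟩
      15 ^ s * (800 ^ d * 4)                       ≡⟨ cong (15 ^ s *_) (sym (collect 800 4)) ⟩
      15 ^ s * ((800 ^ 16) ^ s * ((800 ^ 1) ^ e * 4)) ≡⟨ sym (*-assoc (15 ^ s) ((800 ^ 16) ^ s) ((800 ^ 1) ^ e * 4)) ⟩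
      15 ^ s * (800 ^ 16) ^ s * ((800 ^ 1) ^ e * 4) ≡⟨ cong (_* ((800 ^ 1) ^ e * 4)) (sym (^-distribʳ-* 15 (800 ^ 16) s)) ⟩
      (15 * 800 ^ 16) ^ s * ((800 ^ 1) ^ e * 4)    ∎)
  where
  open ≤-Reasoning
  d = 16 * s + 1 * e
  f = Φ d s
  g = Φ (d + d) (suc (d / 2))
  collect : ∀ a c → (a ^ 16) ^ s * ((a ^ 1) ^ e * c) ≡ a ^ d * c
  collect a c = trans (sym (*-assoc ((a ^ 16) ^ s) ((a ^ 1) ^ e) c)) (cong (_* c) (sym (^-split a 16 1 s e)))
  double : ∀ a → (a * a) ^ d ≡ a ^ (d + d)
  double a = trans (^-distribʳ-* a a d) (sym (^-distribˡ-+-* a d d))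
  units : ∀ f g x y → f * g * (x * y) ≡ f * (1 * x) * (g * (1 * y))
  units = solve-∀
  regroup : ∀ a b c x → a * b * (c * (4 * x)) ≡ b * (a * c * x * 4)
  regroup = solve-∀
  halves : 4 ^ (d / 2) ≤ 2 ^ d
  halves = begin
    4 ^ (d / 2)       ≡⟨ ^-*-assoc 2 2 (d / 2) ⟩
    2 ^ (2 * (d / 2)) ≤⟨ ^-monoʳ-≤ 2 (≤-trans (≤-reflexive (*-comm 2 (d / 2))) (m/n*n≤m d 2)) ⟩
    2 ^ d             ∎

-- The cutoff is close to 15/31 of the number of coordinates, so `Φ-tail` is used at odds 15 : 16.
-- This is the tighter case, growing like 3.996 ^ d.
shattered-bound : ∀ s e L → 10 ≤ s → e < 16 → let d = 16 * s + 1 * e in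
  L ≤ 2 ^ s * Φ (d + d ∸ s) (suc (d ∸ s)) → L * (10 ^ 10) ^ d ≤ 39999999999 ^ d
shattered-bound s e L 10≤s e<16 L≤ =
  -- The exponents are those of `n` = 31s + 2e and `k` = 15s + e. The factor 2 comes from the 2 ^ s
  -- patterns, and the constants 15 and 16 from the extra one in `suc k`.
  cancel-growth (10 ^ 10) 39999999999 (15 ^ 15 * 16 ^ 31) (15 ^ 1 * 16 ^ 2) 15 (2 * (31 ^ 31 * 16 ^ 15)) (31 ^ 2 * 16 ^ 1) 16
    s e L 10≤s
    (from-yes (2 * (31 ^ 31 * 16 ^ 15) * (10 ^ 10) ^ 16 ≤? 39999999999 ^ 16 * (15 ^ 15 * 16 ^ 31)))
    (from-yes (allUpTo? (λ e → (2 * (31 ^ 31 * 16 ^ 15) * (10 ^ 10) ^ 16) ^ 10 * ((31 ^ 2 * 16 ^ 1 * (10 ^ 10) ^ 1) ^ e * 16)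
       ≤? (39999999999 ^ 16 * (15 ^ 15 * 16 ^ 31)) ^ 10 * ((39999999999 ^ 1 * (15 ^ 1 * 16 ^ 2)) ^ e * 15)) 16) e<16)
    (begin
      L * ((15 ^ 15 * 16 ^ 31) ^ s * ((15 ^ 1 * 16 ^ 2) ^ e * 15))
        ≡⟨ cong (L *_) (collect 15 16 15 31 1 2 15) ⟩
      L * (15 * 15 ^ k * 16 ^ n)
        ≤⟨ *-monoˡ-≤ (15 * 15 ^ k * 16 ^ n) L≤ ⟩
      2 ^ s * Φ (d + d ∸ s) (suc (d ∸ s)) * (15 * 15 ^ k * 16 ^ n)
        ≡⟨ cong₂ (λ x y → 2 ^ s * Φ x (suc y) * (15 * 15 ^ k * 16 ^ n)) n≡ k≡ ⟩
      2 ^ s * Φ n (suc k) * (15 ^ suc k * 16 ^ n)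
        ≡⟨ *-assoc (2 ^ s) (Φ n (suc k)) (15 ^ suc k * 16 ^ n) ⟩
      2 ^ s * (Φ n (suc k) * (15 ^ suc k * 16 ^ n))
        ≤⟨ *-monoʳ-≤ (2 ^ s) (Φ-tail {15} {16} (n≤1+n 15) n (suc k)) ⟩
      2 ^ s * (31 ^ n * (16 * 16 ^ k))
        ≡⟨ cong (2 ^ s *_) (move (31 ^ n) 16 (16 ^ k)) ⟩
      2 ^ s * (16 * 31 ^ n * 16 ^ k)
        ≡⟨ cong (2 ^ s *_) (sym (collect 31 16 31 15 2 1 16)) ⟩
      2 ^ s * ((31 ^ 31 * 16 ^ 15) ^ s * ((31 ^ 2 * 16 ^ 1) ^ e * 16))
        ≡⟨ sym (*-assoc (2 ^ s) ((31 ^ 31 * 16 ^ 15) ^ s) ((31 ^ 2 * 16 ^ 1) ^ e * 16)) ⟩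
      2 ^ s * (31 ^ 31 * 16 ^ 15) ^ s * ((31 ^ 2 * 16 ^ 1) ^ e * 16)
        ≡⟨ cong (_* ((31 ^ 2 * 16 ^ 1) ^ e * 16)) (sym (^-distribʳ-* 2 (31 ^ 31 * 16 ^ 15) s)) ⟩
      (2 * (31 ^ 31 * 16 ^ 15)) ^ s * ((31 ^ 2 * 16 ^ 1) ^ e * 16) ∎)
  where
  open ≤-Reasoning
  d = 16 * s + 1 * e
  n = 31 * s + 2 * e
  k = 15 * s + 1 * e
  n≡ : d + d ∸ s ≡ n
  n≡ = trans (cong (_∸ s) (eq s e)) (m+n∸m≡n s n)
    where
    eq : ∀ s e → 16 * s + 1 * e + (16 * s + 1 * e) ≡ s + (31 * s + 2 * e)
    eq = solve-∀
  k≡ : d ∸ s ≡ k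
  k≡ = trans (cong (_∸ s) (eq s e)) (m+n∸m≡n s k)
    where
    eq : ∀ s e → 16 * s + 1 * e ≡ s + (15 * s + 1 * e)
    eq = solve-∀
  move : ∀ a b c → a * (b * c) ≡ b * a * c
  move = solve-∀
  collect : ∀ a b i j i′ j′ c → (a ^ i * b ^ j) ^ s * ((a ^ i′ * b ^ j′) ^ e * c)
                               ≡ c * a ^ (i * s + i′ * e) * b ^ (j * s + j′ * e)
  collect a b i j i′ j′ c = begin-equality
    (a ^ i * b ^ j) ^ s * ((a ^ i′ * b ^ j′) ^ e * c)
      ≡⟨ cong₂ (λ x y → x * (y * c)) (^-distribʳ-* (a ^ i) (b ^ j) s) (^-distribʳ-* (a ^ i′) (b ^ j′) e) ⟩
    (a ^ i) ^ s * (b ^ j) ^ s * ((a ^ i′) ^ e * (b ^ j′) ^ e * c)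
      ≡⟨ shuffle ((a ^ i) ^ s) ((b ^ j) ^ s) ((a ^ i′) ^ e) ((b ^ j′) ^ e) c ⟩
    c * ((a ^ i) ^ s * (a ^ i′) ^ e) * ((b ^ j) ^ s * (b ^ j′) ^ e)
      ≡⟨ sym (cong₂ (λ x y → c * x * y) (^-split a i i′ s e) (^-split b j j′ s e)) ⟩
    c * a ^ (i * s + i′ * e) * b ^ (j * s + j′ * e) ∎
    where
    shuffle : ∀ x y z w c → x * y * (z * w * c) ≡ c * (x * z) * (y * w)
    shuffle = solve-∀

theorem3 : Σ ℕ λ d₀ → (d : ℕ) → d₀ ≤ d → (S : SeqSet) → Maximal d S → ¬ ContainsBall1 S → CardBound d S
theorem3 = 160 , bound
  -- 160 is 16 · 10, which makes `s` at least 10 as `cancel-growth` requires.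
  where
  bound : (d : ℕ) → 160 ≤ d → (S : SeqSet) → Maximal d S → ¬ ContainsBall1 S → CardBound d S
  bound d 160≤d S maximal@((close , c , u , Sc , Su , c-far-u) , _) noBall xs distinct Sxs =
    decidable-stable (length xs * 10 ^ (10 * d) ≤? 39999999999 ^ d) λ fails →
    common-window (u ∷ xs) (close u c Su Sc ∷ All.map (λ {a} Sa → close a c Sa Sc) Sxs) λ { (N , agu ∷ ags) →
    fails (conclude (card-dichotomy close (exists-far maximal noBall) s Sc Su agu c-far-u xs
                      (All.zip (Sxs , ags)) distinct)) }
    where
    open ≤-Reasoning
    -- The fraction 1/16 is small enough for the trace count to stay below the saving in each fibre,
    -- and still large enough for the shattered case to gain.
    s = d / 16
    e = d % 16
    10≤s : 10 ≤ s
    10≤s = /-monoˡ-≤ 16 160≤d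
    d≡ : 16 * s + 1 * e ≡ d
    d≡ = trans (eq s e) (sym (m≡m%n+[m/n]*n d 16))
      where
      eq : ∀ s e → 16 * s + 1 * e ≡ e + s * 16
      eq = solve-∀
    rescale : length xs * (10 ^ 10) ^ (16 * s + 1 * e) ≤ 39999999999 ^ (16 * s + 1 * e) →
              length xs * 10 ^ (10 * d) ≤ 39999999999 ^ d
    rescale le = begin
      length xs * 10 ^ (10 * d)   ≡⟨ cong (length xs *_) (sym (^-*-assoc 10 10 d)) ⟩
      length xs * (10 ^ 10) ^ d   ≤⟨ subst (λ d → length xs * (10 ^ 10) ^ d ≤ 39999999999 ^ d) d≡ le ⟩
      39999999999 ^ d             ∎
    conclude : length xs ≤ Φ d s * Φ (d + d) (suc (d / 2)) ⊎
               length xs ≤ 2 ^ s * Φ (d + d ∸ s) (suc (d ∸ s)) →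
               length xs * 10 ^ (10 * d) ≤ 39999999999 ^ d
    conclude (inj₁ le) = rescale (few-traces-bound s e (length xs) 10≤s (m%n<n d 16)
      (subst (λ d → length xs ≤ Φ d s * Φ (d + d) (suc (d / 2))) (sym d≡) le))
    conclude (inj₂ le) = rescale (shattered-bound s e (length xs) 10≤s (m%n<n d 16)
      (subst (λ d → length xs ≤ 2 ^ s * Φ (d + d ∸ s) (suc (d ∸ s))) (sym d≡) le))
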